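{- Let $V$ be a set of $n$ data points with dissimilarity weights $w_{ij}\in[0,1]$, and let $T^O$ be a binary HC tree on $V$ of maximum dissimilarity. Then for any $\epsilon>0$ there exists an HC tree $\overline T$ on $V$ such that (i) $\overline T$ contains $\Theta(1/\epsilon^2)$ internal nodes, each with at most $3\epsilon^2 n$ children, and (ii) $dis(\overline T)\ge (1-\epsilon)\,dis(T^O)$.
   Context: An HC tree on $V$ is a rooted tree whose leaves are in bijection with $V$ (internal nodes may have two or more children). For an internal node $v$, $|T_v|$ is the number of data points in the subtree rooted at $v$. For data points $i,j$ let $v_i,v_j$ be the children of their lowest common ancestor containing $i$ and $j$ respectively. The dissimilarity is $dis(T)=\sum_{i<j} w_{ij}(|T_{v_i}|+|T_{v_j}|)$; for binary trees this equals $\sum_{i<j} w_{ij}|T_{ij}|$, where $|T_{ij}|$ is the number of leaves in the subtree rooted at the lowest common ancestor of $i,j$.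
   Formalization: Proved for ε < 1 and ε²n ≥ 1 (for small ε²n no tree with at least two children per node can have at most 3ε²n children, and for large ε the Θ(1/ε²) bound fails); the weights and ε are rational rather than real. -}

module Defs where

open import Data.Nat as ℕ using (ℕ; zero; suc)
open import Data.Integer using (+_)
open import Data.Rational using (ℚ; _/_; 0ℚ; _+_; _*_)
open import Data.Fin using (Fin; toℕ; _≟_)
open import Data.Bool using (Bool; true; false; _∧_; if_then_else_)
open import Data.List using (List; []; _∷_; _++_; length; filter; allFin; foldr)
open import Data.Bool.ListAction using (any)
open import Data.List.Relation.Unary.All using (All)
open import Data.List.Relation.Binary.Permutation.Propositional using (_↭_)
open import Data.Maybe using (Maybe; just; nothing)
open import Data.Product using (_×_)
open import Relation.Nullary using (does)
open import Relation.Binary.PropositionalEquality using (_≡_)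

ℕtoℚ : ℕ → ℚ
ℕtoℚ n = + n / 1

data Tree (n : ℕ) : Set where
  leaf : Fin n → Tree n
  node : List (Tree n) → Tree n

module _ {n : ℕ} where
  mutual
    leaves : Tree n → List (Fin n)
    leaves (leaf i) = i ∷ []
    leaves (node cs) = leavesL cs

    leavesL : List (Tree n) → List (Fin n)
    leavesL [] = []
    leavesL (c ∷ cs) = leaves c ++ leavesL cs

  size : Tree n → ℕ
  size t = length (leaves t)

  mutual
    internalNodes : Tree n → List (List (Tree n))
    internalNodes (leaf _) = []
    internalNodes (node cs) = cs ∷ internalNodesL cs

    internalNodesL : List (Tree n) → List (List (Tree n))
    internalNodesL [] = []
    internalNodesL (c ∷ cs) = internalNodes c ++ internalNodesL cs

  numInternal : Tree n → ℕ
  numInternal t = length (internalNodes t)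

  IsHCTree : Tree n → Set
  IsHCTree t = All (λ cs → 2 ℕ.≤ length cs) (internalNodes t) × (leaves t ↭ allFin n)

  IsBinary : Tree n → Set
  IsBinary t = All (λ cs → length cs ≡ 2) (internalNodes t)

  contains : Tree n → Fin n → Bool
  contains t i = any (λ x → does (x ≟ i)) (leaves t)

  sizeContaining : List (Tree n) → Fin n → ℕ
  sizeContaining [] i = 0
  sizeContaining (c ∷ cs) i = if contains c i then size c else sizeContaining cs i

  -- pairCost t i j = |T_{v_i}| + |T_{v_j}|, where v_i, v_j are the children of
  -- lca(i,j) containing i and j respectively.
  mutual
    pairCost : Tree n → Fin n → Fin n → ℕ
    pairCost (leaf _) i j = 0
    pairCost (node cs) i j with sameChild cs i j
    ... | just k = k
    ... | nothing = sizeContaining cs i ℕ.+ sizeContaining cs j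

    sameChild : List (Tree n) → Fin n → Fin n → Maybe ℕ
    sameChild [] i j = nothing
    sameChild (c ∷ cs) i j =
      if contains c i ∧ contains c j then just (pairCost c i j) else sameChild cs i j

  sumℚ : List ℚ → ℚ
  sumℚ = foldr _+_ 0ℚ

  dis : (Fin n → Fin n → ℚ) → Tree n → ℚ
  dis w t = sumℚ (Data.List.map (λ i →
              sumℚ (Data.List.map (λ j → w i j * ℕtoℚ (pairCost t i j))
                     (filter (λ j → toℕ i ℕ.<? toℕ j) (allFin n))))
            (allFin n))

{-# OPTIONS --safe #-}
module Submission where

-- Colour the points at random with q ≈ 2/ε colours. In expectation the equally coloured pairs carry only
-- a fraction ε/2 of dis(T^O), so they may be given up. Walk up T^O, collecting leaves into a pending set
-- until it exceeds m ≈ εn/8 points; then hang the pending points, sorted into monochromatic stars of at most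
-- e ≈ 3ε²n points, one after the other above the part of the tree built so far. A differently coloured pair
-- that is not resolved below keeps that whole part under its lowest common ancestor, so it loses at most 2m.
-- The latter loss is charged to dis(T^O) ≥ n W / 2, where W is the total weight. There are O(1/ε) flushes,
-- each with at most q partially filled stars, whence O(1/ε²) internal nodes. The matching lower bound only
-- counts children: k nodes with at most e children have at most k e leaves.

open import Defs
open import Algebra.Bundles using (CommutativeMonoid)
import Algebra.Properties.CommutativeSemigroup as CommutativeSemigroup
open import Data.Bool using (true; false; if_then_else_; _∧_)
open import Data.Bool.ListAction using (any)
open import Data.Fin as Fin using (Fin; zero; suc)
import Data.Fin.Properties as Fin
open import Data.Integer as ℤ using () renaming (+_ to pos)
import Data.Integer.Properties as ℤ
open import Data.List using (List; []; _∷_; [_]; _++_; length; allFin; map; filter; concat)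
open import Data.List.Membership.Propositional using (_∈_; _∉_)
open import Data.List.Membership.Propositional.Properties using (∈-++⁺ʳ; ∈-++⁻; ∈-filter⁺; ∈-allFin)
open import Data.List.Properties
  using (length-++; length-map; length-tabulate; ++-identityʳ; ++-assoc; concat-++; concat-map-[_]; filter-all; filter-reject)
open import Data.List.Relation.Binary.Disjoint.Propositional using (Disjoint)
open import Data.List.Relation.Binary.Permutation.Propositional
  using (_↭_; ↭-refl; ↭-prep; ↭-sym; ↭-trans; ↭-reflexive; ↭⇒↭ₛ)
import Data.List.Relation.Binary.Permutation.Propositional.Properties as Perm
import Data.List.Relation.Binary.Permutation.Setoid.Properties as PermSetoid
open import Data.List.Relation.Unary.All as All using (All; []; _∷_)
import Data.List.Relation.Unary.All.Properties as All
open import Data.List.Relation.Unary.AllPairs using (AllPairs; []; _∷_)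
import Data.List.Relation.Unary.AllPairs.Properties as AllPairs
open import Data.List.Relation.Unary.Any using (here; there)
open import Data.List.Relation.Unary.Unique.Propositional using (Unique)
import Data.List.Relation.Unary.Unique.Propositional.Properties as Unique
open import Data.Maybe using (Maybe; just; nothing; maybe)
open import Data.Nat as ℕ using (ℕ; zero; suc)
open import Data.Nat.DivMod using (m≡m%n+[m/n]*n; m/n*n≤m; m%n<n)
import Data.Nat.Properties as ℕ
open import Data.Nat.Tactic.RingSolver using (solve-∀)
open import Data.Product using (Σ; ∃; _×_; _,_; proj₁; proj₂)
open import Data.Rational as ℚ using (ℚ; mkℚ; _≤_; _<_; _+_; _*_; _-_; -_; 0ℚ; 1ℚ; 1/_)
import Data.Rational.Properties as ℚ
open import Data.Rational.Solver using (module +-*-Solver)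
open import Data.Rational.Unnormalised as ℚᵘ using (mkℚᵘ; *≡*; *≤*; *<*)
import Data.Rational.Unnormalised.Properties as ℚᵘ
open import Data.Sum using (_⊎_; inj₁; inj₂)
open import Function using (id; _∘_)
open import Relation.Binary.PropositionalEquality hiding ([_])
open import Relation.Nullary using (yes; no; does; contradiction)
open import Relation.Nullary.Decidable using (¬?)
open import Relation.Unary using (Decidable)

open CommutativeSemigroup (CommutativeMonoid.commutativeSemigroup ℚ.+-0-commutativeMonoid) using (interchange)
open +-*-Solver using (solve; _:+_; _:*_; _:-_; :-_; _:=_)

-- Rational numbers

-- `ℕtoℚ n` is normalised through a gcd and does not compute for a variable `n`. The laws of this
-- embedding are therefore checked on unnormalised fractions with denominator 1.
ℕtoℚᵘ : ∀ n → ℚ.toℚᵘ (ℕtoℚ n) ℚᵘ.≃ mkℚᵘ (pos n) 0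
ℕtoℚᵘ n = ℚ.toℚᵘ-fromℚᵘ (mkℚᵘ (pos n) 0)

ℕtoℚ-+ : ∀ m n → ℕtoℚ (m ℕ.+ n) ≡ ℕtoℚ m + ℕtoℚ n
ℕtoℚ-+ m n = ℚ.toℚᵘ-injective (begin-equality
  ℚ.toℚᵘ (ℕtoℚ (m ℕ.+ n))              ≃⟨ ℕtoℚᵘ (m ℕ.+ n) ⟩
  mkℚᵘ (pos (m ℕ.+ n)) 0                 ≃⟨ *≡* (cong (ℤ._* pos 1) (sym (cong₂ ℤ._+_ (ℤ.*-identityʳ (pos m)) (ℤ.*-identityʳ (pos n))))) ⟩
  mkℚᵘ (pos m) 0 ℚᵘ.+ mkℚᵘ (pos n) 0        ≃⟨ ℚᵘ.+-cong (ℕtoℚᵘ m) (ℕtoℚᵘ n) ⟨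
  ℚ.toℚᵘ (ℕtoℚ m) ℚᵘ.+ ℚ.toℚᵘ (ℕtoℚ n)  ≃⟨ ℚ.toℚᵘ-homo-+ (ℕtoℚ m) (ℕtoℚ n) ⟨
  ℚ.toℚᵘ (ℕtoℚ m + ℕtoℚ n)             ∎)
  where open ℚᵘ.≤-Reasoning

ℕtoℚ-* : ∀ m n → ℕtoℚ (m ℕ.* n) ≡ ℕtoℚ m * ℕtoℚ n
ℕtoℚ-* m n = ℚ.toℚᵘ-injective (begin-equality
  ℚ.toℚᵘ (ℕtoℚ (m ℕ.* n))              ≃⟨ ℕtoℚᵘ (m ℕ.* n) ⟩
  mkℚᵘ (pos (m ℕ.* n)) 0                 ≃⟨ *≡* (cong (ℤ._* pos 1) (ℤ.pos-* m n)) ⟩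
  mkℚᵘ (pos m) 0 ℚᵘ.* mkℚᵘ (pos n) 0        ≃⟨ ℚᵘ.*-cong (ℕtoℚᵘ m) (ℕtoℚᵘ n) ⟨
  ℚ.toℚᵘ (ℕtoℚ m) ℚᵘ.* ℚ.toℚᵘ (ℕtoℚ n)  ≃⟨ ℚ.toℚᵘ-homo-* (ℕtoℚ m) (ℕtoℚ n) ⟨
  ℚ.toℚᵘ (ℕtoℚ m * ℕtoℚ n)             ∎)
  where open ℚᵘ.≤-Reasoning

ℕtoℚ-mono-≤ : ∀ {m n} → m ℕ.≤ n → ℕtoℚ m ≤ ℕtoℚ n
ℕtoℚ-mono-≤ {m} {n} m≤n = ℚ.toℚᵘ-cancel-≤ (begin
  ℚ.toℚᵘ (ℕtoℚ m)  ≃⟨ ℕtoℚᵘ m ⟩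
  mkℚᵘ (pos m) 0     ≤⟨ *≤* (ℤ.*-monoʳ-≤-nonNeg (pos 1) (ℤ.+≤+ m≤n)) ⟩
  mkℚᵘ (pos n) 0     ≃⟨ ℕtoℚᵘ n ⟨
  ℚ.toℚᵘ (ℕtoℚ n)  ∎)
  where open ℚᵘ.≤-Reasoning

ℕtoℚ-cancel-< : ∀ {m n} → ℕtoℚ m < ℕtoℚ n → m ℕ.< n
ℕtoℚ-cancel-< m<n = ℕ.≰⇒> (λ n≤m → ℚ.<-irrefl refl (ℚ.<-≤-trans m<n (ℕtoℚ-mono-≤ n≤m)))

0≤ℕtoℚ : ∀ n → 0ℚ ≤ ℕtoℚ n
0≤ℕtoℚ n = ℕtoℚ-mono-≤ (ℕ.z≤n {n})

*-monoˡ-≤ : ∀ {p q r} → 0ℚ ≤ r → p ≤ q → r * p ≤ r * q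
*-monoˡ-≤ {r = r} 0≤r = ℚ.*-monoˡ-≤-nonNeg r {{ℚ.nonNegative 0≤r}}

*-monoʳ-≤ : ∀ {p q r} → 0ℚ ≤ r → p ≤ q → p * r ≤ q * r
*-monoʳ-≤ {r = r} 0≤r = ℚ.*-monoʳ-≤-nonNeg r {{ℚ.nonNegative 0≤r}}

*-cancelʳ-≤ : ∀ {p q r} → 0ℚ < r → p * r ≤ q * r → p ≤ q
*-cancelʳ-≤ {r = r} 0<r = ℚ.*-cancelʳ-≤-pos r {{ℚ.positive 0<r}}

0≤* : ∀ {p q} → 0ℚ ≤ p → 0ℚ ≤ q → 0ℚ ≤ p * q
0≤* {p} {q} 0≤p 0≤q = subst (_≤ p * q) (ℚ.*-zeroʳ p) (*-monoˡ-≤ 0≤p 0≤q)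

-- Euclidean division of the numerator by the denominator yields the floor. It serves to round the
-- real parameters of the construction to natural numbers.
⌊⌋-exists : ∀ x → 0ℚ ≤ x → ∃ λ k → ℕtoℚ k ≤ x × x < ℕtoℚ (suc k)
⌊⌋-exists (mkℚ ℤ.-[1+ a ] d _) (ℚ.*≤* ())
⌊⌋-exists x@(mkℚ (pos a) d _) _ = k , ℚ.toℚᵘ-cancel-≤ k≤x , ℚ.toℚᵘ-cancel-< x<k+1
  where
  open ℚᵘ.≤-Reasoning
  k = a ℕ./ suc d

  k≤x : ℚ.toℚᵘ (ℕtoℚ k) ℚᵘ.≤ mkℚᵘ (pos a) d
  k≤x = begin
    ℚ.toℚᵘ (ℕtoℚ k)  ≃⟨ ℕtoℚᵘ k ⟩
    mkℚᵘ (pos k) 0     ≤⟨ *≤* (subst₂ ℤ._≤_ (ℤ.pos-* k (suc d)) (sym (ℤ.*-identityʳ (pos a))) (ℤ.+≤+ (m/n*n≤m a (suc d)))) ⟩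
    mkℚᵘ (pos a) d     ∎

  a<[k+1]d : a ℕ.< suc k ℕ.* suc d
  a<[k+1]d = subst (ℕ._< suc k ℕ.* suc d) (sym (m≡m%n+[m/n]*n a (suc d)))
                   (ℕ.+-monoˡ-< (k ℕ.* suc d) (m%n<n a (suc d)))

  x<k+1 : mkℚᵘ (pos a) d ℚᵘ.< ℚ.toℚᵘ (ℕtoℚ (suc k))
  x<k+1 = begin-strict
    mkℚᵘ (pos a) d           <⟨ *<* (subst₂ ℤ._<_ (sym (ℤ.*-identityʳ (pos a))) (ℤ.pos-* (suc k) (suc d)) (ℤ.+<+ a<[k+1]d)) ⟩
    mkℚᵘ (pos (suc k)) 0       ≃⟨ ℕtoℚᵘ (suc k) ⟨
    ℚ.toℚᵘ (ℕtoℚ (suc k))  ∎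

-- Sums and colourings

module _ {A : Set} where

  ∑ : List A → (A → ℚ) → ℚ
  ∑ []       g = 0ℚ
  ∑ (x ∷ xs) g = g x + ∑ xs g

  ∑-mono-≤ : ∀ xs {g h : A → ℚ} → (∀ {x} → x ∈ xs → g x ≤ h x) → ∑ xs g ≤ ∑ xs h
  ∑-mono-≤ []       g≤h = ℚ.≤-refl
  ∑-mono-≤ (x ∷ xs) g≤h = ℚ.+-mono-≤ (g≤h (here refl)) (∑-mono-≤ xs (g≤h ∘ there))

  ∑-+ : ∀ xs (g h : A → ℚ) → ∑ xs (λ x → g x + h x) ≡ ∑ xs g + ∑ xs h
  ∑-+ []       g h = refl
  ∑-+ (x ∷ xs) g h rewrite ∑-+ xs g h = interchange (g x) (h x) (∑ xs g) (∑ xs h)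

  ∑-*ˡ : ∀ c xs (g : A → ℚ) → ∑ xs (λ x → c * g x) ≡ c * ∑ xs g
  ∑-*ˡ c []       g = sym (ℚ.*-zeroʳ c)
  ∑-*ˡ c (x ∷ xs) g rewrite ∑-*ˡ c xs g = sym (ℚ.*-distribˡ-+ c (g x) (∑ xs g))

  ∑-zero : ∀ xs → ∑ xs (λ _ → 0ℚ) ≡ 0ℚ
  ∑-zero []       = refl
  ∑-zero (x ∷ xs) rewrite ∑-zero xs = refl

  ∑-const : ∀ xs c → ∑ xs (λ _ → c) ≡ ℕtoℚ (length xs) * c
  ∑-const []       c = sym (ℚ.*-zeroˡ c)
  ∑-const (x ∷ xs) c rewrite ∑-const xs c | ℕtoℚ-+ 1 (length xs) =
    trans (cong (_+ ℕtoℚ (length xs) * c) (sym (ℚ.*-identityˡ c))) (sym (ℚ.*-distribʳ-+ c 1ℚ (ℕtoℚ (length xs))))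

  -- Unordered pairs are listed by their earlier member, so removing the head removes exactly its
  -- pairs. This fits the point-by-point induction in `colouring`.
  pairSum : List A → (A → A → ℚ) → ℚ
  pairSum []       u = 0ℚ
  pairSum (x ∷ xs) u = ∑ xs (u x) + pairSum xs u

  pairSum-mono-≤ : ∀ xs {u v : A → A → ℚ} → (∀ {x y} → x ∈ xs → y ∈ xs → u x y ≤ v x y) →
                   pairSum xs u ≤ pairSum xs v
  pairSum-mono-≤ []       u≤v = ℚ.≤-refl
  pairSum-mono-≤ (x ∷ xs) u≤v = ℚ.+-mono-≤ (∑-mono-≤ xs (u≤v (here refl) ∘ there))
                                           (pairSum-mono-≤ xs (λ p q → u≤v (there p) (there q)))

  pairSum-+ : ∀ xs (u v : A → A → ℚ) → pairSum xs (λ x y → u x y + v x y) ≡ pairSum xs u + pairSum xs v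
  pairSum-+ []       u v = refl
  pairSum-+ (x ∷ xs) u v rewrite pairSum-+ xs u v | ∑-+ xs (u x) (v x) =
    interchange (∑ xs (u x)) (∑ xs (v x)) (pairSum xs u) (pairSum xs v)

  pairSum-*ˡ : ∀ c xs (u : A → A → ℚ) → pairSum xs (λ x y → c * u x y) ≡ c * pairSum xs u
  pairSum-*ˡ c []       u = sym (ℚ.*-zeroʳ c)
  pairSum-*ˡ c (x ∷ xs) u rewrite pairSum-*ˡ c xs u | ∑-*ˡ c xs (u x) =
    sym (ℚ.*-distribˡ-+ c (∑ xs (u x)) (pairSum xs u))

  pairSum-zero : ∀ xs → pairSum xs (λ _ _ → 0ℚ) ≡ 0ℚ
  pairSum-zero []       = refl
  pairSum-zero (x ∷ xs) rewrite pairSum-zero xs | ∑-zero xs = refl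

  0≤pairSum : ∀ xs {u : A → A → ℚ} → (∀ x y → 0ℚ ≤ u x y) → 0ℚ ≤ pairSum xs u
  0≤pairSum xs {u} 0≤u = subst (_≤ pairSum xs u) (pairSum-zero xs) (pairSum-mono-≤ xs (λ _ _ → 0≤u _ _))

∑-swap : ∀ {A B : Set} (xs : List A) (ys : List B) (g : A → B → ℚ) →
         ∑ xs (λ x → ∑ ys (g x)) ≡ ∑ ys (λ y → ∑ xs (λ x → g x y))
∑-swap []       ys g = sym (∑-zero ys)
∑-swap (x ∷ xs) ys g = trans (cong (λ s → ∑ ys (g x) + s) (∑-swap xs ys g)) (sym (∑-+ ys (g x) _))

argmin : ∀ {k} (g : Fin (suc k) → ℚ) → ∃ λ c → ∀ d → g c ≤ g d
argmin {zero}  g = zero , λ { zero → ℚ.≤-refl }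
argmin {suc k} g with argmin (g ∘ suc)
... | c , c≤ with ℚ.≤-total (g zero) (g (suc c))
... | inj₁ z≤c = zero  , λ { zero → ℚ.≤-refl ; (suc d) → ℚ.≤-trans z≤c (c≤ d) }
... | inj₂ c≤z = suc c , λ { zero → c≤z ; (suc d) → c≤ d }

-- The minimum is at most the average; multiplying by the number of terms avoids a division.
≤-average : ∀ {k} (g : Fin (suc k) → ℚ) → ∃ λ c → ℕtoℚ (suc k) * g c ≤ ∑ (allFin (suc k)) g
≤-average {k} g with argmin g
... | c , c≤ = c , (begin
  ℕtoℚ (suc k) * g c                   ≡⟨ cong (λ l → ℕtoℚ l * g c) (length-tabulate {n = suc k} id) ⟨
  ℕtoℚ (length (allFin (suc k))) * g c ≡⟨ ∑-const (allFin (suc k)) (g c) ⟨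
  ∑ (allFin (suc k)) (λ _ → g c)       ≤⟨ ∑-mono-≤ (allFin (suc k)) (λ {d} _ → c≤ d) ⟩
  ∑ (allFin (suc k)) g                 ∎)
  where open ℚ.≤-Reasoning

-- The entries of `cs` are distinct, so at most one summand differs from zero.
∑-indicator : ∀ {k} cs → Unique cs → (d : Fin k) {v : ℚ} → 0ℚ ≤ v →
              ∑ cs (λ c → if does (c Fin.≟ d) then v else 0ℚ) ≤ v
∑-indicator []       _          d 0≤v = 0≤v
∑-indicator (c ∷ cs) (c∉ ∷ uniq) d {v} 0≤v with c Fin.≟ d
... | no  _    = ℚ.≤-trans (ℚ.≤-reflexive (ℚ.+-identityˡ _)) (∑-indicator cs uniq d 0≤v)
... | yes refl = ℚ.≤-reflexive (trans (cong (v +_) (off-diagonal c∉)) (ℚ.+-identityʳ v))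
  where
  off-diagonal : ∀ {cs} → All (c ≢_) cs → ∑ cs (λ c′ → if does (c′ Fin.≟ c) then v else 0ℚ) ≡ 0ℚ
  off-diagonal [] = refl
  off-diagonal {c′ ∷ _} (c≢c′ ∷ c∉) with c′ Fin.≟ c
  ... | yes c′≡c = contradiction (sym c′≡c) c≢c′
  ... | no  _    = trans (ℚ.+-identityˡ _) (off-diagonal c∉)

-- The part of `u` carried by the pairs that the colouring fails to separate.
monoWeight : ∀ {n k} → (Fin n → Fin k) → (Fin n → Fin n → ℚ) → Fin n → Fin n → ℚ
monoWeight f u x y = if does (f x Fin.≟ f y) then u x y else 0ℚ

0≤monoWeight : ∀ {n k} (f : Fin n → Fin k) (u : Fin n → Fin n → ℚ) → (∀ x y → 0ℚ ≤ u x y) →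
               ∀ x y → 0ℚ ≤ monoWeight f u x y
0≤monoWeight f u 0≤u x y with f x Fin.≟ f y
... | yes _ = 0≤u x y
... | no  _ = ℚ.≤-refl

-- Turns an estimate for separated pairs into one for all pairs: an equally coloured pair is paid
-- for in full by the second summand.
monoWeight-split : ∀ {n k} (f : Fin n → Fin k) (u v : Fin n → Fin n → ℚ) i j →
                   0ℚ ≤ v i j → (f i ≢ f j → u i j ≤ v i j) → u i j ≤ v i j + monoWeight f u i j
monoWeight-split f u v i j 0≤v apart≤ with f i Fin.≟ f j
... | yes _ = ℚ.≤-trans (ℚ.≤-reflexive (sym (ℚ.+-identityˡ (u i j)))) (ℚ.+-monoˡ-≤ (u i j) 0≤v)
... | no  p = ℚ.≤-trans (apart≤ p) (ℚ.≤-reflexive (sym (ℚ.+-identityʳ (v i j))))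

-- Greedy derandomisation of a uniformly random colouring: each new point takes the colour
-- that shares the least weight with the points already coloured.
colouring : ∀ {n} k (u : Fin n → Fin n → ℚ) → (∀ x y → 0ℚ ≤ u x y) → ∀ xs → Unique xs →
            ∃ λ (f : Fin n → Fin (suc k)) → ℕtoℚ (suc k) * pairSum xs (monoWeight f u) ≤ pairSum xs u
colouring k u 0≤u []       _           = (λ _ → zero) , ℚ.≤-reflexive (ℚ.*-zeroʳ (ℕtoℚ (suc k)))
colouring {n} k u 0≤u (x ∷ xs) (x∉ ∷ uniq) with colouring k u 0≤u xs uniq
... | f , f≤ with ≤-average (λ c → ∑ xs (λ y → if does (c Fin.≟ f y) then u x y else 0ℚ))
... | c , c≤ = f′ , (begin
  q * (∑ xs (monoWeight f′ u x) + pairSum xs (monoWeight f′ u))  ≡⟨ ℚ.*-distribˡ-+ q _ _ ⟩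
  q * ∑ xs (monoWeight f′ u x) + q * pairSum xs (monoWeight f′ u)
    ≤⟨ ℚ.+-mono-≤ (*-monoˡ-≤ (0≤ℕtoℚ (suc k)) (∑-mono-≤ xs new))
                  (*-monoˡ-≤ (0≤ℕtoℚ (suc k)) (pairSum-mono-≤ xs old)) ⟩
  q * ∑ xs (share c) + q * pairSum xs (monoWeight f u)             ≤⟨ ℚ.+-mono-≤ c≤ f≤ ⟩
  ∑ (allFin (suc k)) (λ d → ∑ xs (share d)) + pairSum xs u            ≡⟨ cong (_+ pairSum xs u) (∑-swap (allFin (suc k)) xs share) ⟩
  ∑ xs (λ y → ∑ (allFin (suc k)) (λ d → share d y)) + pairSum xs u
    -- Among all colours for `x`, only `f y` makes the pair of `x` and `y` monochromatic, so the sum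
    -- over the colours counts `u x y` at most once.
    ≤⟨ ℚ.+-monoˡ-≤ (pairSum xs u) (∑-mono-≤ xs (λ {y} _ → ∑-indicator _ (Unique.allFin⁺ (suc k)) (f y) (0≤u x y))) ⟩
  ∑ xs (u x) + pairSum xs u                                           ∎)
  where
  open ℚ.≤-Reasoning
  q = ℕtoℚ (suc k)

  share : Fin (suc k) → Fin n → ℚ
  share c y = if does (c Fin.≟ f y) then u x y else 0ℚ

  -- Only `x` is recoloured. As `x` does not occur in `xs`, the pairs within `xs` keep their status.
  f′ : Fin n → Fin (suc k)
  f′ y = if does (y Fin.≟ x) then c else f y

  f′-new : f′ x ≡ c
  f′-new with x Fin.≟ x
  ... | yes _   = refl
  ... | no  x≢x = contradiction refl x≢x

  f′-old : ∀ {y} → y ∈ xs → f′ y ≡ f y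
  f′-old {y} y∈ with y Fin.≟ x
  ... | yes refl = contradiction refl (All.lookup x∉ y∈)
  ... | no  _    = refl

  new : ∀ {y} → y ∈ xs → monoWeight f′ u x y ≤ share c y
  new y∈ rewrite f′-new | f′-old y∈ = ℚ.≤-refl

  old : ∀ {y z} → y ∈ xs → z ∈ xs → monoWeight f′ u y z ≤ monoWeight f u y z
  old y∈ z∈ rewrite f′-old y∈ | f′-old z∈ = ℚ.≤-refl

-- Dissimilarity as a sum over pairs

sum-map : ∀ {n} {A : Set} (xs : List A) (g : A → ℚ) → sumℚ {n} (map g xs) ≡ ∑ xs g
sum-map []       g = refl
sum-map {n} (x ∷ xs) g = cong (g x +_) (sum-map {n} xs g)

-- `allFin n` is increasing, so filtering it by `i < j` leaves exactly the part of the list behind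
-- `i`.
dis-pairSum : ∀ {n} (w : Fin n → Fin n → ℚ) t →
              dis w t ≡ pairSum (allFin n) (λ i j → w i j * ℕtoℚ (pairCost t i j))
dis-pairSum {n} w t = trans (sum-map {n} (allFin n) _) (trans (∑-cong (allFin n) (λ i → sum-map {n} (after i (allFin n)) (u i)))
  (increasing (allFin n) (AllPairs.tabulate⁺-< id)))
  where
  u : Fin n → Fin n → ℚ
  u i j = w i j * ℕtoℚ (pairCost t i j)
  after : Fin n → List (Fin n) → List (Fin n)
  after i = filter (λ j → Fin.toℕ i ℕ.<? Fin.toℕ j)

  ∑-cong : ∀ (xs : List (Fin n)) {g h : Fin n → ℚ} → (∀ i → g i ≡ h i) → ∑ xs g ≡ ∑ xs h
  ∑-cong []       eq = refl
  ∑-cong (x ∷ xs) eq = cong₂ _+_ (eq x) (∑-cong xs eq)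

  skip : ∀ x ys zs → All (x Fin.<_) ys → ∑ ys (λ i → ∑ (after i (x ∷ zs)) (u i)) ≡ ∑ ys (λ i → ∑ (after i zs) (u i))
  skip x []       zs []         = refl
  skip x (y ∷ ys) zs (x<y ∷ x<) = cong₂ _+_
    (cong (λ l → ∑ l (u y)) (filter-reject (λ j → Fin.toℕ y ℕ.<? Fin.toℕ j) (ℕ.<⇒≯ x<y)))
    (skip x ys zs x<)

  increasing : ∀ xs → AllPairs Fin._<_ xs → ∑ xs (λ i → ∑ (after i xs) (u i)) ≡ pairSum xs u
  increasing []       _          = refl
  increasing (x ∷ xs) (x< ∷ inc) = cong₂ _+_
    (cong (λ l → ∑ l (u x)) (trans (filter-reject (λ j → Fin.toℕ x ℕ.<? Fin.toℕ j) (ℕ.<-irrefl refl))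
                                   (filter-all _ x<)))
    (trans (skip x xs xs x<) (increasing xs inc))

-- Splitting lists into blocks

Unique-resp-↭ : {A : Set} {xs ys : List A} → xs ↭ ys → Unique xs → Unique ys
Unique-resp-↭ {A} p = PermSetoid.Unique-resp-↭ (setoid A) (↭⇒↭ₛ p)

Unique-++⁻ : {A : Set} (xs : List A) {ys : List A} → Unique (xs ++ ys) → Unique xs × Unique ys × Disjoint xs ys
Unique-++⁻ []       uniq        = [] , uniq , λ ()
Unique-++⁻ (x ∷ xs) (x∉ ∷ uniq) with Unique-++⁻ xs uniq
... | uxs , uys , xs#ys = All.++⁻ˡ xs x∉ ∷ uxs , uys , λ where
  (here refl , x∈ys) → contradiction refl (All.lookup (All.++⁻ʳ xs x∉) x∈ys)
  (there v∈  , v∈ys) → xs#ys (v∈ , v∈ys)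

filter-complement-↭ : {A : Set} {P : A → Set} (P? : Decidable P) (xs : List A) →
                      filter P? xs ++ filter (¬? ∘ P?) xs ↭ xs
filter-complement-↭ P? []       = ↭-refl
filter-complement-↭ P? (x ∷ xs) with P? x
... | yes _ = ↭-prep x (filter-complement-↭ P? xs)
... | no  _ = ↭-trans (Perm.shift x (filter P? xs) _) (↭-prep x (filter-complement-↭ P? xs))

Monochromatic : {A : Set} → (A → ℕ) → List A → Set
Monochromatic f b = ∀ {x y} → x ∈ b → y ∈ b → f x ≡ f y

module _ {A : Set} {e : ℕ} (1≤e : 1 ℕ.≤ e) where

  -- The summand `e` on the right pays for the one block that may remain partly filled.
  blocks : {Q : A → Set} (xs : List A) → All Q xs →
           ∃ λ bs → concat bs ≡ xs × All (λ b → length b ℕ.≤ e × All Q b) bs × length bs ℕ.* e ℕ.≤ length xs ℕ.+ e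
  blocks {Q} xs qs with greedy xs qs
    where
    -- Only the first block, which is still being filled, may have fewer than e elements.
    greedy : ∀ xs → All Q xs → ∃ λ b → ∃ λ bs → b ++ concat bs ≡ xs × length b ℕ.≤ e × All Q b ×
             All (λ b → length b ℕ.≤ e × All Q b) bs × length bs ℕ.* e ℕ.≤ length (concat bs)
    greedy []       []       = [] , [] , refl , ℕ.z≤n , [] , [] , ℕ.z≤n
    greedy (x ∷ xs) (q ∷ qs) with greedy xs qs
    ... | b , bs , eq , b≤ , qb , qbs , count with length b ℕ.<? e
    ... | yes b<e = x ∷ b , bs , cong (x ∷_) eq , b<e , q ∷ qb , qbs , count
    ... | no  b≮e = [ x ] , b ∷ bs , cong (x ∷_) eq , 1≤e , q ∷ [] , (b≤ , qb) ∷ qbs ,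
                    ℕ.≤-trans (ℕ.+-mono-≤ (ℕ.≮⇒≥ b≮e) count) (ℕ.≤-reflexive (sym (length-++ b)))
  ... | b , bs , refl , b≤ , qb , qbs , count = b ∷ bs , refl , (b≤ , qb) ∷ qbs , (begin
    e ℕ.+ length bs ℕ.* e            ≤⟨ ℕ.+-monoʳ-≤ e (ℕ.≤-trans count (ℕ.m≤n+m _ (length b))) ⟩
    e ℕ.+ (length b ℕ.+ length (concat bs)) ≡⟨ cong (e ℕ.+_) (length-++ b) ⟨
    e ℕ.+ length (b ++ concat bs)    ≡⟨ ℕ.+-comm e _ ⟩
    length (b ++ concat bs) ℕ.+ e    ∎)
    where open ℕ.≤-Reasoning

  -- Induction on the number of colours: the class of the largest colour is cut into blocks on its
  -- own. Each class leaves at most one partly filled block, whence the slack `q * e`.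
  monochromaticBlocks : (f : A → ℕ) → ∀ q xs → All (λ x → f x ℕ.< q) xs →
    ∃ λ bs → concat bs ↭ xs × All (λ b → length b ℕ.≤ e × Monochromatic f b) bs ×
             length bs ℕ.* e ℕ.≤ length xs ℕ.+ q ℕ.* e
  monochromaticBlocks f zero    []       []       = [] , ↭-refl , [] , ℕ.z≤n
  monochromaticBlocks f (suc q) xs f<
    with blocks (filter (λ x → f x ℕ.≟ q) xs) (All.all-filter (λ x → f x ℕ.≟ q) xs)
       | monochromaticBlocks f q (filter (λ x → ¬? (f x ℕ.≟ q)) xs)
           (All.zipWith (λ (fx≢q , fx<) → ℕ.≤∧≢⇒< (ℕ.≤-pred fx<) fx≢q)
             (All.all-filter (λ x → ¬? (f x ℕ.≟ q)) xs , All.filter⁺ (λ x → ¬? (f x ℕ.≟ q)) f<))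
  ... | bs , eq , ok , count | bs′ , perm , ok′ , count′ =
    bs ++ bs′ ,
    ↭-trans (↭-reflexive (sym (concat-++ bs bs′)))
      (↭-trans (Perm.++⁺ (↭-reflexive eq) perm) split) ,
    All.++⁺ (All.map (λ (l , eqs) → l , λ {_} {_} x∈ y∈ → trans (All.lookup eqs x∈) (sym (All.lookup eqs y∈))) ok) ok′ ,
    (begin
      length (bs ++ bs′) ℕ.* e                             ≡⟨ cong (ℕ._* e) (length-++ bs) ⟩
      (length bs ℕ.+ length bs′) ℕ.* e                     ≡⟨ ℕ.*-distribʳ-+ e (length bs) (length bs′) ⟩
      length bs ℕ.* e ℕ.+ length bs′ ℕ.* e                 ≤⟨ ℕ.+-mono-≤ count count′ ⟩
      (length hits ℕ.+ e) ℕ.+ (length rest ℕ.+ q ℕ.* e)   ≡⟨ ℕ-interchange (length hits) e (length rest) (q ℕ.* e) ⟩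
      (length hits ℕ.+ length rest) ℕ.+ (e ℕ.+ q ℕ.* e)   ≡⟨ cong (ℕ._+ (e ℕ.+ q ℕ.* e)) (trans (sym (length-++ hits)) (Perm.↭-length split)) ⟩
      length xs ℕ.+ suc q ℕ.* e                            ∎)
    where
    open ℕ.≤-Reasoning
    open CommutativeSemigroup ℕ.+-commutativeSemigroup using () renaming (interchange to ℕ-interchange)
    hits = filter (λ x → f x ℕ.≟ q) xs
    rest = filter (λ x → ¬? (f x ℕ.≟ q)) xs
    split = filter-complement-↭ (λ x → f x ℕ.≟ q) xs

-- Joining trees

module _ {n : ℕ} where

  contains-∈ : ∀ t {i : Fin n} → i ∈ leaves t → contains t i ≡ true
  contains-∈ t = go (leaves t)
    where
    go : ∀ xs {i : Fin n} → i ∈ xs → any (λ x → does (x Fin.≟ i)) xs ≡ true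
    go (x ∷ xs) {i} i∈ with x Fin.≟ i | i∈
    ... | yes _   | _          = refl
    ... | no  x≢i | here refl  = contradiction refl x≢i
    ... | no  _   | there i∈xs = go xs i∈xs

  contains-∉ : ∀ t {i : Fin n} → i ∉ leaves t → contains t i ≡ false
  contains-∉ t = go (leaves t)
    where
    go : ∀ xs {i : Fin n} → i ∉ xs → any (λ x → does (x Fin.≟ i)) xs ≡ false
    go []       _  = refl
    go (x ∷ xs) {i} i∉ with x Fin.≟ i
    ... | yes refl = contradiction (here refl) i∉
    ... | no  _    = go xs (i∉ ∘ there)

  -- `pairCost` is stuck on its `with`; this form computes as soon as the membership tests are
  -- rewritten.
  pairCost-binary : ∀ (a b : Tree n) i j → pairCost (node (a ∷ b ∷ [])) i j ≡
    (if contains a i ∧ contains a j then pairCost a i j else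
     if contains b i ∧ contains b j then pairCost b i j else
     (if contains a i then size a else if contains b i then size b else 0) ℕ.+
     (if contains a j then size a else if contains b j then size b else 0))
  pairCost-binary a b i j with contains a i ∧ contains a j | contains b i ∧ contains b j
  ... | true  | _     = refl
  ... | false | true  = refl
  ... | false | false = refl

  -- `nothing` stands for the empty tree, which is the core as long as no point has been flushed;
  -- `node []` would violate the arity condition.
  leavesᴹ : Maybe (Tree n) → List (Fin n)
  leavesᴹ = maybe leaves []

  internalNodesᴹ : Maybe (Tree n) → List (List (Tree n))
  internalNodesᴹ = maybe internalNodes []

  sizeᴹ : Maybe (Tree n) → ℕ
  sizeᴹ t = length (leavesᴹ t)

  pairCostᴹ : Maybe (Tree n) → Fin n → Fin n → ℕ
  pairCostᴹ nothing  i j = 0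
  pairCostᴹ (just t) i j = pairCost t i j

  -- One more than the number of internal nodes, which makes it additive over _⊕_.
  weight : Maybe (Tree n) → ℕ
  weight nothing  = 0
  weight (just t) = suc (numInternal t)

  infixr 5 _⊕_
  -- With the empty tree as a unit, joining never creates a node with a single child.
  _⊕_ : Maybe (Tree n) → Maybe (Tree n) → Maybe (Tree n)
  nothing ⊕ y       = y
  just a  ⊕ nothing = just a
  just a  ⊕ just b  = just (node (a ∷ b ∷ []))

  leaves-⊕ : ∀ x y → leavesᴹ (x ⊕ y) ≡ leavesᴹ x ++ leavesᴹ y
  leaves-⊕ nothing  y        = refl
  leaves-⊕ (just a) nothing  = sym (++-identityʳ (leaves a))
  leaves-⊕ (just a) (just b) = cong (leaves a ++_) (++-identityʳ (leaves b))

  size-⊕ : ∀ x y → sizeᴹ (x ⊕ y) ≡ sizeᴹ x ℕ.+ sizeᴹ y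
  size-⊕ x y = trans (cong length (leaves-⊕ x y)) (length-++ (leavesᴹ x))

  weight-⊕ : ∀ x y → weight (x ⊕ y) ≡ weight x ℕ.+ weight y
  weight-⊕ nothing  y        = refl
  weight-⊕ (just a) nothing  = sym (ℕ.+-identityʳ _)
  weight-⊕ (just a) (just b) = cong suc (trans
    (cong suc (trans (length-++ (internalNodes a))
                     (cong (λ l → numInternal a ℕ.+ length l) (++-identityʳ (internalNodes b)))))
    (sym (ℕ.+-suc (numInternal a) (numInternal b))))

  internalNodes-⊕ : ∀ {Q : List (Tree n) → Set} → (∀ cs → length cs ≡ 2 → Q cs) → ∀ x y →
    All Q (internalNodesᴹ x) → All Q (internalNodesᴹ y) → All Q (internalNodesᴹ (x ⊕ y))
  internalNodes-⊕ q₂ nothing  y        qx qy = qy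
  internalNodes-⊕ q₂ (just a) nothing  qx qy = qx
  internalNodes-⊕ q₂ (just a) (just b) qx qy = q₂ _ refl ∷ All.++⁺ qx (All.++⁺ qy [])

  pairCost-⊕ˡ : ∀ x y {i j} → i ∈ leavesᴹ x → j ∈ leavesᴹ x → pairCostᴹ (x ⊕ y) i j ≡ pairCostᴹ x i j
  pairCost-⊕ˡ (just a) nothing  i∈ j∈ = refl
  pairCost-⊕ˡ (just a) (just b) {i} {j} i∈ j∈
    rewrite pairCost-binary a b i j | contains-∈ a i∈ | contains-∈ a j∈ = refl

  pairCost-⊕ʳ : ∀ x y → Disjoint (leavesᴹ x) (leavesᴹ y) → ∀ {i j} →
                i ∈ leavesᴹ y → j ∈ leavesᴹ y → pairCostᴹ (x ⊕ y) i j ≡ pairCostᴹ y i j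
  pairCost-⊕ʳ nothing  y        x#y i∈ j∈ = refl
  pairCost-⊕ʳ (just a) (just b) x#y {i} {j} i∈ j∈
    rewrite pairCost-binary a b i j | contains-∉ a (λ i∈a → x#y (i∈a , i∈)) | contains-∈ b i∈ | contains-∈ b j∈ = refl

  pairCost-⊕-lr : ∀ x y → Disjoint (leavesᴹ x) (leavesᴹ y) → ∀ {i j} →
                  i ∈ leavesᴹ x → j ∈ leavesᴹ y → pairCostᴹ (x ⊕ y) i j ≡ sizeᴹ (x ⊕ y)
  pairCost-⊕-lr (just a) (just b) x#y {i} {j} i∈ j∈
    rewrite pairCost-binary a b i j | contains-∈ a i∈ | contains-∉ a (λ j∈a → x#y (j∈a , j∈))
          | contains-∉ b (λ i∈b → x#y (i∈ , i∈b)) | contains-∈ b j∈ = sym (size-⊕ (just a) (just b))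

  pairCost-⊕-rl : ∀ x y → Disjoint (leavesᴹ x) (leavesᴹ y) → ∀ {i j} →
                  i ∈ leavesᴹ y → j ∈ leavesᴹ x → pairCostᴹ (x ⊕ y) i j ≡ sizeᴹ (x ⊕ y)
  pairCost-⊕-rl (just a) (just b) x#y {i} {j} i∈ j∈
    rewrite pairCost-binary a b i j | contains-∈ a j∈ | contains-∉ a (λ i∈a → x#y (i∈a , i∈))
          | contains-∉ b (λ j∈b → x#y (j∈ , j∈b)) | contains-∈ b i∈ =
    trans (ℕ.+-comm (size b) (size a)) (sym (size-⊕ (just a) (just b)))

  -- The two ways of being separated share one constructor, because either way the root is the
  -- lowest common ancestor and the pair pays for the whole tree.
  data Location (x y : Maybe (Tree n)) (i j : Fin n) : Set where
    bothˡ : i ∈ leavesᴹ x → j ∈ leavesᴹ x → pairCostᴹ (x ⊕ y) i j ≡ pairCostᴹ x i j → Location x y i j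
    bothʳ : i ∈ leavesᴹ y → j ∈ leavesᴹ y → pairCostᴹ (x ⊕ y) i j ≡ pairCostᴹ y i j → Location x y i j
    apart : pairCostᴹ (x ⊕ y) i j ≡ sizeᴹ (x ⊕ y) → Location x y i j

  locate : ∀ x y → Disjoint (leavesᴹ x) (leavesᴹ y) → ∀ {i j} →
           i ∈ leavesᴹ (x ⊕ y) → j ∈ leavesᴹ (x ⊕ y) → Location x y i j
  locate x y x#y {i} {j} i∈ j∈
    with ∈-++⁻ (leavesᴹ x) (subst (i ∈_) (leaves-⊕ x y) i∈)
       | ∈-++⁻ (leavesᴹ x) (subst (j ∈_) (leaves-⊕ x y) j∈)
  ... | inj₁ i∈x | inj₁ j∈x = bothˡ i∈x j∈x (pairCost-⊕ˡ x y i∈x j∈x)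
  ... | inj₂ i∈y | inj₂ j∈y = bothʳ i∈y j∈y (pairCost-⊕ʳ x y x#y i∈y j∈y)
  ... | inj₁ i∈x | inj₂ j∈y = apart (pairCost-⊕-lr x y x#y i∈x j∈y)
  ... | inj₂ i∈y | inj₁ j∈x = apart (pairCost-⊕-rl x y x#y i∈y j∈x)

  pairCost-≤-size : ∀ (t : Tree n) → IsBinary t → ∀ i j → pairCost t i j ℕ.≤ size t
  pairCost-≤-size (leaf _) _ i j = ℕ.z≤n
  pairCost-≤-size (node (a ∷ b ∷ [])) (_ ∷ bin) i j =
    subst (pairCost (node (a ∷ b ∷ [])) i j ℕ.≤_) (sym (size-⊕ (just a) (just b))) bound
    where
    bin-a = All.++⁻ˡ (internalNodes a) bin
    bin-b = All.++⁻ˡ (internalNodes b) (All.++⁻ʳ (internalNodes a) bin)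
    a≤ = ℕ.≤-trans (pairCost-≤-size a bin-a i j) (ℕ.m≤m+n (size a) (size b))
    b≤ = ℕ.≤-trans (pairCost-≤-size b bin-b i j) (ℕ.m≤n+m (size b) (size a))
    bound : pairCost (node (a ∷ b ∷ [])) i j ℕ.≤ size a ℕ.+ size b
    -- All outcomes of the four tests are treated, also those that cannot occur for two leaves of a
    -- tree without repetitions.
    bound rewrite pairCost-binary a b i j with contains a i | contains a j | contains b i | contains b j
    ... | true  | true  | _     | _     = a≤
    ... | true  | false | true  | true  = b≤
    ... | true  | false | true  | false = ℕ.+-monoʳ-≤ (size a) ℕ.z≤n
    ... | true  | false | false | true  = ℕ.≤-refl
    ... | true  | false | false | false = ℕ.+-monoʳ-≤ (size a) ℕ.z≤n
    ... | false | true  | true  | true  = b≤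
    ... | false | true  | true  | false = ℕ.≤-reflexive (ℕ.+-comm (size b) (size a))
    ... | false | true  | false | true  = ℕ.m≤m+n (size a) (size b)
    ... | false | true  | false | false = ℕ.m≤m+n (size a) (size b)
    ... | false | false | true  | true  = b≤
    ... | false | false | true  | false = ℕ.≤-trans (ℕ.≤-reflexive (ℕ.+-identityʳ (size b))) (ℕ.m≤n+m (size b) (size a))
    ... | false | false | false | true  = ℕ.m≤n+m (size b) (size a)
    ... | false | false | false | false = ℕ.z≤n

  -- Empty and singleton blocks are treated apart in order to keep every internal node at two or
  -- more children.
  star : List (Fin n) → Maybe (Tree n)
  star []           = nothing
  star (x ∷ [])     = just (leaf x)
  star (x ∷ y ∷ zs) = just (node (map leaf (x ∷ y ∷ zs)))

  leavesL-leaf : ∀ xs → leavesL (map (leaf {n}) xs) ≡ xs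
  leavesL-leaf []       = refl
  leavesL-leaf (x ∷ xs) = cong (x ∷_) (leavesL-leaf xs)

  internalNodesL-leaf : ∀ xs → internalNodesL (map (leaf {n}) xs) ≡ []
  internalNodesL-leaf []       = refl
  internalNodesL-leaf (x ∷ xs) = internalNodesL-leaf xs

  leaves-star : ∀ xs → leavesᴹ (star xs) ≡ xs
  leaves-star []           = refl
  leaves-star (x ∷ [])     = refl
  leaves-star (x ∷ y ∷ zs) = leavesL-leaf (x ∷ y ∷ zs)

  -- One unit for the star itself and one for the node that will join it to the rest.
  weight-star : ∀ xs → weight (star xs) ℕ.≤ 2
  weight-star []           = ℕ.z≤n
  weight-star (x ∷ [])     = ℕ.s≤s ℕ.z≤n
  weight-star (x ∷ y ∷ zs) rewrite internalNodesL-leaf zs = ℕ.≤-refl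

  Arity : ℕ → List (Tree n) → Set
  Arity e cs = 2 ℕ.≤ length cs × length cs ℕ.≤ e

  arity-star : ∀ {e} xs → length xs ℕ.≤ e → All (Arity e) (internalNodesᴹ (star xs))
  arity-star []           _  = []
  arity-star (x ∷ [])     _  = []
  arity-star (x ∷ y ∷ zs) ≤e rewrite internalNodesL-leaf zs =
    (ℕ.s≤s (ℕ.s≤s ℕ.z≤n) , subst (λ l → 2 ℕ.+ l ℕ.≤ _) (sym (length-map leaf zs)) ≤e) ∷ []

  -- A spine with `x` at its bottom: all of `x` lies below every spine node from which a block
  -- hangs.
  attach : List (List (Fin n)) → Maybe (Tree n) → Maybe (Tree n)
  attach []       x = x
  attach (b ∷ bs) x = star b ⊕ attach bs x

  leaves-attach : ∀ bs x → leavesᴹ (attach bs x) ≡ concat bs ++ leavesᴹ x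
  leaves-attach []       x = refl
  leaves-attach (b ∷ bs) x = trans (leaves-⊕ (star b) (attach bs x))
    (trans (cong₂ _++_ (leaves-star b) (leaves-attach bs x)) (sym (++-assoc b (concat bs) (leavesᴹ x))))

  weight-attach : ∀ bs x → weight (attach bs x) ℕ.≤ length bs ℕ.* 2 ℕ.+ weight x
  weight-attach []       x = ℕ.≤-refl
  weight-attach (b ∷ bs) x = ℕ.≤-trans (ℕ.≤-reflexive (weight-⊕ (star b) (attach bs x)))
    (ℕ.+-mono-≤ (weight-star b) (weight-attach bs x))

  internalNodes-attach : ∀ {Q : List (Tree n) → Set} → (∀ cs → length cs ≡ 2 → Q cs) → ∀ bs x →
    All (λ b → All Q (internalNodesᴹ (star b))) bs → All Q (internalNodesᴹ x) → All Q (internalNodesᴹ (attach bs x))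
  internalNodes-attach q₂ []       x _         qx = qx
  internalNodes-attach q₂ (b ∷ bs) x (qb ∷ qs) qx =
    internalNodes-⊕ q₂ (star b) (attach bs x) qb (internalNodes-attach q₂ bs x qs qx)

  ⊕-disjoint : ∀ x y → Unique (leavesᴹ (x ⊕ y)) →
               Unique (leavesᴹ x) × Unique (leavesᴹ y) × Disjoint (leavesᴹ x) (leavesᴹ y)
  ⊕-disjoint x y u = Unique-++⁻ (leavesᴹ x) (subst Unique (leaves-⊕ x y) u)

  -- Differently coloured points never share a block. Hence they either both lie in `x` or are
  -- separated at a spine node, whose subtree contains all of `x`.
  pairCost-attach : ∀ {f : Fin n → ℕ} bs x → Unique (leavesᴹ (attach bs x)) →
    All (Monochromatic f) bs →
    ∀ {i j} → i ∈ leavesᴹ (attach bs x) → j ∈ leavesᴹ (attach bs x) → f i ≢ f j →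
    (i ∈ leavesᴹ x × j ∈ leavesᴹ x × pairCostᴹ (attach bs x) i j ≡ pairCostᴹ x i j)
    ⊎ sizeᴹ x ℕ.≤ pairCostᴹ (attach bs x) i j
  pairCost-attach []       x u mono i∈ j∈ fi≢fj = inj₁ (i∈ , j∈ , refl)
  pairCost-attach {f} (b ∷ bs) x u (mono ∷ monos) {i} {j} i∈ j∈ fi≢fj
    with ⊕-disjoint (star b) (attach bs x) u
  ... | _ , u′ , b#bs with locate (star b) (attach bs x) b#bs i∈ j∈
  ... | bothˡ i∈b j∈b _ =
    contradiction (mono (subst (i ∈_) (leaves-star b) i∈b) (subst (j ∈_) (leaves-star b) j∈b)) fi≢fj
  ... | apart eq = inj₂ (begin
    sizeᴹ x                              ≤⟨ ℕ.m≤n+m _ _ ⟩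
    length (concat (b ∷ bs)) ℕ.+ sizeᴹ x ≡⟨ length-++ (concat (b ∷ bs)) ⟨
    length (concat (b ∷ bs) ++ leavesᴹ x) ≡⟨ cong length (leaves-attach (b ∷ bs) x) ⟨
    sizeᴹ (attach (b ∷ bs) x)            ≡⟨ eq ⟨
    pairCostᴹ (attach (b ∷ bs) x) i j    ∎)
    where open ℕ.≤-Reasoning
  ... | bothʳ i∈′ j∈′ eq with pairCost-attach bs x u′ monos i∈′ j∈′ fi≢fj
  ... | inj₁ (i∈x , j∈x , eq′) = inj₁ (i∈x , j∈x , trans eq eq′)
  ... | inj₂ x≤ = inj₂ (ℕ.≤-trans x≤ (ℕ.≤-reflexive (sym eq)))

-- Coarsening a binary tree

module _ {n q m e : ℕ} (2≤e : 2 ℕ.≤ e) (f : Fin n → Fin q) where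

  arity-2 : ∀ (cs : List (Tree n)) → length cs ≡ 2 → Arity e cs
  arity-2 _ eq = ℕ.≤-reflexive (sym eq) , ℕ.≤-trans (ℕ.≤-reflexive eq) 2≤e

  -- The state of the walk at the subtree t: core is the tree built so far on the leaves that are not pending.
  record Sketch (t : Tree n) (pending : List (Fin n)) (flushes : ℕ) : Set where
    field
      core      : Maybe (Tree n)
      partition : pending ++ leavesᴹ core ↭ leaves t
      arity     : All (Arity e) (internalNodesᴹ core)
      -- Up to the factor 2, full stars are charged to their leaves and partly filled ones, at most
      -- `q` per flush, to the flushes.
      light     : weight core ℕ.* e ℕ.≤ 2 ℕ.* (sizeᴹ core ℕ.+ flushes ℕ.* (q ℕ.* e))
      loss      : ∀ {i j} → i ∈ leavesᴹ core → j ∈ leavesᴹ core → f i ≢ f j →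
                  pairCost t i j ℕ.≤ pairCostᴹ core i j ℕ.+ 2 ℕ.* m

    size-partition : length pending ℕ.+ sizeᴹ core ≡ size t
    size-partition = trans (sym (length-++ pending)) (Perm.↭-length partition)

  open Sketch

  -- A differently coloured pair resolved inside the old core keeps its estimate. Any other pays at
  -- least the size of that core, and `bound` says that `t` charges it at most `2 m` more.
  flush : ∀ {t pending k} (s : Sketch t pending k) → Unique (leaves t) →
          (∀ i j → pairCost t i j ℕ.≤ sizeᴹ (core s) ℕ.+ 2 ℕ.* m) → Sketch t [] (suc k)
  flush {t} {pending} {k} s uniq bound
    with monochromaticBlocks (ℕ.<⇒≤ 2≤e) (Fin.toℕ ∘ f) q pending (All.tabulate λ {x} _ → Fin.toℕ<n (f x))
  ... | bs , bs↭pending , ok , count = record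
    { core      = core′
    ; partition = partition′
    ; arity     = internalNodes-attach arity-2 bs (core s)
                    (All.map (λ {b} → arity-star b ∘ proj₁) ok) (arity s)
    ; light     = light′
    ; loss      = loss′
    }
    where
    core′ = attach bs (core s)

    partition′ : leavesᴹ core′ ↭ leaves t
    partition′ = ↭-trans (↭-reflexive (leaves-attach bs (core s)))
      (↭-trans (Perm.++⁺ʳ (leavesᴹ (core s)) bs↭pending) (partition s))

    light′ : weight core′ ℕ.* e ℕ.≤ 2 ℕ.* (sizeᴹ core′ ℕ.+ suc k ℕ.* (q ℕ.* e))
    light′ = begin
      weight core′ ℕ.* e                                      ≤⟨ ℕ.*-monoˡ-≤ e (weight-attach bs (core s)) ⟩
      (length bs ℕ.* 2 ℕ.+ weight (core s)) ℕ.* e             ≡⟨ expand (length bs) (weight (core s)) e ⟩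
      2 ℕ.* (length bs ℕ.* e) ℕ.+ weight (core s) ℕ.* e       ≤⟨ ℕ.+-mono-≤ (ℕ.*-monoʳ-≤ 2 count) (light s) ⟩
      2 ℕ.* (length pending ℕ.+ q ℕ.* e) ℕ.+ 2 ℕ.* (sizeᴹ (core s) ℕ.+ k ℕ.* (q ℕ.* e))
                                                              ≡⟨ collect (length pending) (q ℕ.* e) (sizeᴹ (core s)) k ⟩
      2 ℕ.* ((length pending ℕ.+ sizeᴹ (core s)) ℕ.+ suc k ℕ.* (q ℕ.* e))
        ≡⟨ cong (λ l → 2 ℕ.* (l ℕ.+ suc k ℕ.* (q ℕ.* e))) (trans (size-partition s) (sym (Perm.↭-length partition′))) ⟩
      2 ℕ.* (sizeᴹ core′ ℕ.+ suc k ℕ.* (q ℕ.* e))             ∎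
      where
      open ℕ.≤-Reasoning
      expand : ∀ l w e → (l ℕ.* 2 ℕ.+ w) ℕ.* e ≡ 2 ℕ.* (l ℕ.* e) ℕ.+ w ℕ.* e
      expand = solve-∀
      collect : ∀ p c s k → 2 ℕ.* (p ℕ.+ c) ℕ.+ 2 ℕ.* (s ℕ.+ k ℕ.* c) ≡ 2 ℕ.* ((p ℕ.+ s) ℕ.+ suc k ℕ.* c)
      collect = solve-∀

    loss′ : ∀ {i j} → i ∈ leavesᴹ core′ → j ∈ leavesᴹ core′ → f i ≢ f j →
            pairCost t i j ℕ.≤ pairCostᴹ core′ i j ℕ.+ 2 ℕ.* m
    loss′ {i} {j} i∈ j∈ fi≢fj
      with pairCost-attach bs (core s) (Unique-resp-↭ (↭-sym partition′) uniq) (All.map proj₂ ok) i∈ j∈ (fi≢fj ∘ Fin.toℕ-injective)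
    ... | inj₁ (i∈c , j∈c , eq) = subst (λ c → pairCost t i j ℕ.≤ c ℕ.+ 2 ℕ.* m) (sym eq) (loss s i∈c j∈c fi≢fj)
    ... | inj₂ core≤            = ℕ.≤-trans (bound i j) (ℕ.+-monoˡ-≤ (2 ℕ.* m) core≤)

  -- The invariant between two steps of the walk. Each flush so far moved more than `m` points into
  -- the core, and no point ever leaves it, so the size of the core limits the number of flushes.
  Settled : Tree n → Set
  Settled t = ∃ λ pending → ∃ λ k → Σ (Sketch t pending k) λ s →
              length pending ℕ.≤ m × k ℕ.* suc m ℕ.≤ sizeᴹ (core s)

  settle : ∀ {t pending k} (s : Sketch t pending k) → Unique (leaves t) →
           (∀ i j → pairCost t i j ℕ.≤ sizeᴹ (core s) ℕ.+ 2 ℕ.* m) →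
           k ℕ.* suc m ℕ.≤ sizeᴹ (core s) → Settled t
  settle {t} {pending} {k} s uniq bound k≤ with length pending ℕ.≤? m
  ... | yes p≤m = pending , k , s , p≤m , k≤
  -- The pending points, more than `m` of them, pay for the additional flush; afterwards the core
  -- covers the whole subtree.
  ... | no  p≰m = [] , suc k , flush s uniq bound , ℕ.z≤n , (begin
    suc m ℕ.+ k ℕ.* suc m              ≤⟨ ℕ.+-mono-≤ (ℕ.≰⇒> p≰m) k≤ ⟩
    length pending ℕ.+ sizeᴹ (core s)  ≡⟨ size-partition s ⟩
    size t                             ≡⟨ size-partition (flush s uniq bound) ⟨
    sizeᴹ (core (flush s uniq bound))  ∎)
    where open ℕ.≤-Reasoning

  -- Each side leaves at most `m` points pending, so the joined core misses at most `2 m` leaves of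
  -- the subtree. This is the origin of the `2 m` in `loss`.
  merge : ∀ {l r pₗ pᵣ kₗ kᵣ} → Unique (leaves (node (l ∷ r ∷ []))) → IsBinary (node (l ∷ r ∷ [])) →
          length pₗ ℕ.≤ m → length pᵣ ℕ.≤ m → (sₗ : Sketch l pₗ kₗ) (sᵣ : Sketch r pᵣ kᵣ) →
          Σ (Sketch (node (l ∷ r ∷ [])) (pₗ ++ pᵣ) (kₗ ℕ.+ kᵣ)) λ s →
            core s ≡ core sₗ ⊕ core sᵣ × (∀ i j → pairCost (node (l ∷ r ∷ [])) i j ℕ.≤ sizeᴹ (core s) ℕ.+ 2 ℕ.* m)
  merge {l} {r} {pₗ} {pᵣ} {kₗ} {kᵣ} uniq binary pₗ≤ pᵣ≤ sₗ sᵣ = record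
    { core      = c
    ; partition = partition′
    ; arity     = internalNodes-⊕ arity-2 cₗ cᵣ (arity sₗ) (arity sᵣ)
    ; light     = light′
    ; loss      = loss′
    } , refl , bound
    where
    t = node (l ∷ r ∷ [])
    cₗ = core sₗ
    cᵣ = core sᵣ
    c = cₗ ⊕ cᵣ
    l#r = proj₂ (proj₂ (⊕-disjoint (just l) (just r) uniq))

    partition′ : (pₗ ++ pᵣ) ++ leavesᴹ c ↭ leaves t
    partition′ = ↭-trans (↭-reflexive (trans (cong ((pₗ ++ pᵣ) ++_) (leaves-⊕ cₗ cᵣ)) (++-assoc pₗ pᵣ _)))
      (↭-trans (Perm.++⁺ˡ pₗ (Perm.shifts pᵣ (leavesᴹ cₗ)))
      (↭-trans (↭-reflexive (sym (++-assoc pₗ (leavesᴹ cₗ) _)))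
      (↭-trans (Perm.++⁺ (partition sₗ) (partition sᵣ)) (↭-reflexive (sym (leaves-⊕ (just l) (just r)))))))

    light′ : weight c ℕ.* e ℕ.≤ 2 ℕ.* (sizeᴹ c ℕ.+ (kₗ ℕ.+ kᵣ) ℕ.* (q ℕ.* e))
    light′ = begin
      weight c ℕ.* e                           ≡⟨ cong (ℕ._* e) (weight-⊕ cₗ cᵣ) ⟩
      (weight cₗ ℕ.+ weight cᵣ) ℕ.* e          ≡⟨ ℕ.*-distribʳ-+ e (weight cₗ) (weight cᵣ) ⟩
      weight cₗ ℕ.* e ℕ.+ weight cᵣ ℕ.* e      ≤⟨ ℕ.+-mono-≤ (light sₗ) (light sᵣ) ⟩
      2 ℕ.* (sizeᴹ cₗ ℕ.+ kₗ ℕ.* (q ℕ.* e)) ℕ.+ 2 ℕ.* (sizeᴹ cᵣ ℕ.+ kᵣ ℕ.* (q ℕ.* e))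
                                               ≡⟨ collect (sizeᴹ cₗ) kₗ (sizeᴹ cᵣ) kᵣ (q ℕ.* e) ⟩
      2 ℕ.* ((sizeᴹ cₗ ℕ.+ sizeᴹ cᵣ) ℕ.+ (kₗ ℕ.+ kᵣ) ℕ.* (q ℕ.* e))
                                               ≡⟨ cong (λ z → 2 ℕ.* (z ℕ.+ (kₗ ℕ.+ kᵣ) ℕ.* (q ℕ.* e))) (size-⊕ cₗ cᵣ) ⟨
      2 ℕ.* (sizeᴹ c ℕ.+ (kₗ ℕ.+ kᵣ) ℕ.* (q ℕ.* e)) ∎
      where
      open ℕ.≤-Reasoning
      collect : ∀ s k s′ k′ c → 2 ℕ.* (s ℕ.+ k ℕ.* c) ℕ.+ 2 ℕ.* (s′ ℕ.+ k′ ℕ.* c)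
                              ≡ 2 ℕ.* ((s ℕ.+ s′) ℕ.+ (k ℕ.+ k′) ℕ.* c)
      collect = solve-∀

    bound : ∀ i j → pairCost t i j ℕ.≤ sizeᴹ c ℕ.+ 2 ℕ.* m
    bound i j = begin
      pairCost t i j                      ≤⟨ pairCost-≤-size t binary i j ⟩
      size t                              ≡⟨ trans (sym (length-++ (pₗ ++ pᵣ))) (Perm.↭-length partition′) ⟨
      length (pₗ ++ pᵣ) ℕ.+ sizeᴹ c       ≡⟨ cong (ℕ._+ sizeᴹ c) (length-++ pₗ) ⟩
      (length pₗ ℕ.+ length pᵣ) ℕ.+ sizeᴹ c ≤⟨ ℕ.+-monoˡ-≤ (sizeᴹ c) (ℕ.+-mono-≤ pₗ≤ (ℕ.≤-trans pᵣ≤ (ℕ.m≤m+n m 0))) ⟩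
      2 ℕ.* m ℕ.+ sizeᴹ c                 ≡⟨ ℕ.+-comm (2 ℕ.* m) (sizeᴹ c) ⟩
      sizeᴹ c ℕ.+ 2 ℕ.* m                 ∎
      where open ℕ.≤-Reasoning

    c-disjoint = proj₂ (proj₂ (⊕-disjoint cₗ cᵣ
      (proj₁ (proj₂ (Unique-++⁻ (pₗ ++ pᵣ) (Unique-resp-↭ (↭-sym partition′) uniq))))))

    ∈-l : ∀ {i} → i ∈ leavesᴹ cₗ → i ∈ leaves l
    ∈-l i∈ = Perm.∈-resp-↭ (partition sₗ) (∈-++⁺ʳ pₗ i∈)

    ∈-r : ∀ {i} → i ∈ leavesᴹ cᵣ → i ∈ leaves r
    ∈-r i∈ = Perm.∈-resp-↭ (partition sᵣ) (∈-++⁺ʳ pᵣ i∈)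

    loss′ : ∀ {i j} → i ∈ leavesᴹ c → j ∈ leavesᴹ c → f i ≢ f j →
            pairCost t i j ℕ.≤ pairCostᴹ c i j ℕ.+ 2 ℕ.* m
    loss′ {i} {j} i∈ j∈ fi≢fj with locate cₗ cᵣ c-disjoint i∈ j∈
    ... | apart eq = subst (λ z → pairCost t i j ℕ.≤ z ℕ.+ 2 ℕ.* m) (sym eq) (bound i j)
    -- A pair on one side keeps its cost under both joins, in the given tree and in the core, so the
    -- estimate is inherited.
    ... | bothˡ i∈ₗ j∈ₗ eq = subst₂ (λ y z → y ℕ.≤ z ℕ.+ 2 ℕ.* m)
      (sym (pairCost-⊕ˡ (just l) (just r) (∈-l i∈ₗ) (∈-l j∈ₗ))) (sym eq) (loss sₗ i∈ₗ j∈ₗ fi≢fj)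
    ... | bothʳ i∈ᵣ j∈ᵣ eq = subst₂ (λ y z → y ℕ.≤ z ℕ.+ 2 ℕ.* m)
      (sym (pairCost-⊕ʳ (just l) (just r) l#r (∈-r i∈ᵣ) (∈-r j∈ᵣ))) (sym eq) (loss sᵣ i∈ᵣ j∈ᵣ fi≢fj)

  sketch : ∀ t → IsBinary t → Unique (leaves t) → Settled t
  -- The point starts out pending over an empty core; it is flushed at once only if `m` is 0.
  sketch (leaf x) _ uniq = settle unit uniq (λ _ _ → ℕ.z≤n) ℕ.z≤n
    where
    unit : Sketch (leaf x) [ x ] 0
    unit = record { core = nothing ; partition = ↭-refl ; arity = [] ; light = ℕ.z≤n ; loss = λ () }
  sketch t@(node (l ∷ r ∷ [])) binary@(_ ∷ bin) uniq
    with ⊕-disjoint (just l) (just r) uniq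
  ... | uniqₗ , uniqᵣ , _
    with sketch l (All.++⁻ˡ (internalNodes l) bin) uniqₗ
       | sketch r (All.++⁻ˡ (internalNodes r) (All.++⁻ʳ (internalNodes l) bin)) uniqᵣ
  ... | _ , kₗ , sₗ , pₗ≤ , kₗ≤ | _ , kᵣ , sᵣ , pᵣ≤ , kᵣ≤
    with merge uniq binary pₗ≤ pᵣ≤ sₗ sᵣ
  ... | s , eq , bound = settle s uniq bound (begin
    (kₗ ℕ.+ kᵣ) ℕ.* suc m                      ≡⟨ ℕ.*-distribʳ-+ (suc m) kₗ kᵣ ⟩
    kₗ ℕ.* suc m ℕ.+ kᵣ ℕ.* suc m              ≤⟨ ℕ.+-mono-≤ kₗ≤ kᵣ≤ ⟩
    sizeᴹ (core sₗ) ℕ.+ sizeᴹ (core sᵣ)        ≡⟨ size-⊕ (core sₗ) (core sᵣ) ⟨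
    sizeᴹ (core sₗ ⊕ core sᵣ)                  ≡⟨ cong sizeᴹ eq ⟨
    sizeᴹ (core s)                             ∎)
    where open ℕ.≤-Reasoning

  -- A last flush empties the pending set whatever its size. It is not backed by `suc m` points,
  -- hence `suc k` in the weight estimate next to `k` in the flush count.
  coarsening : ∀ t → IsBinary t → Unique (leaves t) →
    ∃ λ c → ∃ λ k → leavesᴹ c ↭ leaves t × All (Arity e) (internalNodesᴹ c) ×
      k ℕ.* suc m ℕ.≤ size t × weight c ℕ.* e ℕ.≤ 2 ℕ.* (size t ℕ.+ suc k ℕ.* (q ℕ.* e)) ×
      (∀ {i j} → i ∈ leaves t → j ∈ leaves t → f i ≢ f j → pairCost t i j ℕ.≤ pairCostᴹ c i j ℕ.+ 2 ℕ.* m)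
  coarsening t binary uniq with sketch t binary uniq
  ... | pending , k , s , p≤ , k≤ = core s′ , k , partition s′ , arity s′ ,
    ℕ.≤-trans k≤ core≤t ,
    subst (λ z → weight (core s′) ℕ.* e ℕ.≤ 2 ℕ.* (z ℕ.+ suc k ℕ.* (q ℕ.* e))) (size-partition s′) (light s′) ,
    λ i∈ j∈ → loss s′ (Perm.∈-resp-↭ (↭-sym (partition s′)) i∈) (Perm.∈-resp-↭ (↭-sym (partition s′)) j∈)
    where
    open ℕ.≤-Reasoning
    core≤t : sizeᴹ (core s) ℕ.≤ size t
    core≤t = ℕ.≤-trans (ℕ.m≤n+m _ (length pending)) (ℕ.≤-reflexive (size-partition s))

    bound : ∀ i j → pairCost t i j ℕ.≤ sizeᴹ (core s) ℕ.+ 2 ℕ.* m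
    bound i j = begin
      pairCost t i j                    ≤⟨ pairCost-≤-size t binary i j ⟩
      size t                            ≡⟨ size-partition s ⟨
      length pending ℕ.+ sizeᴹ (core s) ≤⟨ ℕ.+-monoˡ-≤ (sizeᴹ (core s)) (ℕ.≤-trans p≤ (ℕ.m≤m+n m _)) ⟩
      2 ℕ.* m ℕ.+ sizeᴹ (core s)        ≡⟨ ℕ.+-comm (2 ℕ.* m) (sizeᴹ (core s)) ⟩
      sizeᴹ (core s) ℕ.+ 2 ℕ.* m        ∎

    s′ = flush s uniq bound

-- Leaves bounded by internal nodes and arity

module _ {n e : ℕ} where
  mutual
    -- Every node except the root is a child of some internal node; the 1 accounts for a root that
    -- is itself a leaf.
    size-≤ : (t : Tree n) → All (λ cs → length cs ℕ.≤ e) (internalNodes t) → size t ℕ.≤ 1 ℕ.+ numInternal t ℕ.* e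
    size-≤ (leaf _)  _     = ℕ.≤-refl
    size-≤ (node cs) arity = ℕ.m≤n⇒m≤1+n (size-node-≤ cs arity)

    size-node-≤ : ∀ (cs : List (Tree n)) → All (λ cs → length cs ℕ.≤ e) (internalNodes (node cs)) →
                  size (node cs) ℕ.≤ numInternal (node cs) ℕ.* e
    size-node-≤ cs (cs≤e ∷ arity) = ℕ.≤-trans (sizeL-≤ cs arity) (ℕ.+-monoˡ-≤ _ cs≤e)

    sizeL-≤ : ∀ (cs : List (Tree n)) → All (λ cs → length cs ℕ.≤ e) (internalNodesL cs) →
              length (leavesL cs) ℕ.≤ length cs ℕ.+ length (internalNodesL cs) ℕ.* e
    sizeL-≤ []       _     = ℕ.z≤n
    sizeL-≤ (c ∷ cs) arity = begin
      length (leaves c ++ leavesL cs)      ≡⟨ length-++ (leaves c) ⟩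
      size c ℕ.+ length (leavesL cs)       ≤⟨ ℕ.+-mono-≤ (size-≤ c (All.++⁻ˡ (internalNodes c) arity))
                                                         (sizeL-≤ cs (All.++⁻ʳ (internalNodes c) arity)) ⟩
      (1 ℕ.+ numInternal c ℕ.* e) ℕ.+ (length cs ℕ.+ length (internalNodesL cs) ℕ.* e)
                                           ≡⟨ collect (numInternal c) (length cs) (length (internalNodesL cs)) e ⟩
      suc (length cs) ℕ.+ (numInternal c ℕ.+ length (internalNodesL cs)) ℕ.* e
                                           ≡⟨ cong (λ k → suc (length cs) ℕ.+ k ℕ.* e) (length-++ (internalNodes c)) ⟨
      suc (length cs) ℕ.+ length (internalNodes c ++ internalNodesL cs) ℕ.* e ∎
      where
      open ℕ.≤-Reasoning
      collect : ∀ a l b e → (1 ℕ.+ a ℕ.* e) ℕ.+ (l ℕ.+ b ℕ.* e) ≡ suc l ℕ.+ (a ℕ.+ b) ℕ.* e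
      collect = solve-∀

-- Binary trees cutting at the root, and the total weight

module _ {n : ℕ} where

  size-spanning : (t : Tree n) → leaves t ↭ allFin n → size t ≡ n
  size-spanning t t↭ = trans (Perm.↭-length t↭) (length-tabulate {n = n} id)

  unwrap : 1 ℕ.≤ n → (c : Maybe (Tree n)) → leavesᴹ c ↭ allFin n → ∃ λ t → c ≡ just t
  unwrap _   (just t) _  = t , refl
  unwrap 1≤n nothing  c↭ =
    contradiction (subst (1 ℕ.≤_) (sym (trans (Perm.↭-length c↭) (length-tabulate {n = n} id))) 1≤n) λ ()

  -- Stars of single points are leaves, so all internal nodes are binary spine nodes.
  caterpillar : List (Fin n) → Maybe (Tree n)
  caterpillar xs = attach (map [_] xs) nothing

  leaves-caterpillar : ∀ xs → leavesᴹ (caterpillar xs) ≡ xs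
  leaves-caterpillar xs = trans (leaves-attach (map [_] xs) nothing) (trans (++-identityʳ _) (concat-map-[ xs ]))

  binary-caterpillar : ∀ xs → All (λ cs → length cs ≡ 2) (internalNodesᴹ (caterpillar xs))
  binary-caterpillar xs = internalNodes-attach (λ _ eq → eq) (map [_] xs) nothing
    (All.map⁺ (All.tabulate λ _ → [])) []

  -- The two colour classes form the two sides of the root, so the lowest common ancestor of a
  -- separated pair is the root. If one class is empty, the join is the other caterpillar and no
  -- pair is separated.
  bisection : 1 ℕ.≤ n → (f : Fin n → Fin 2) →
              ∃ λ t → IsHCTree t × IsBinary t × (∀ i j → f i ≢ f j → pairCost t i j ≡ n)
  bisection 1≤n f = t , (All.map (ℕ.≤-reflexive ∘ sym) binary , t↭) , binary , full
    where
    left = filter (λ i → f i Fin.≟ zero) (allFin n)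
    right = filter (λ i → ¬? (f i Fin.≟ zero)) (allFin n)
    x = caterpillar left
    y = caterpillar right

    spanning : leavesᴹ (x ⊕ y) ↭ allFin n
    spanning = ↭-trans
      (↭-reflexive (trans (leaves-⊕ x y) (cong₂ _++_ (leaves-caterpillar left) (leaves-caterpillar right))))
      (filter-complement-↭ (λ i → f i Fin.≟ zero) (allFin n))

    t = proj₁ (unwrap 1≤n (x ⊕ y) spanning)
    eq = proj₂ (unwrap 1≤n (x ⊕ y) spanning)

    t↭ : leaves t ↭ allFin n
    t↭ = subst (λ c → leavesᴹ c ↭ allFin n) eq spanning

    binary : IsBinary t
    binary = subst (All _ ∘ internalNodesᴹ) eq
      (internalNodes-⊕ (λ _ p → p) x y (binary-caterpillar left) (binary-caterpillar right))

    x#y = proj₂ (proj₂ (⊕-disjoint x y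
      (Unique-resp-↭ (↭-sym spanning) (Unique.allFin⁺ n))))

    inˡ : ∀ {i} → f i ≡ zero → i ∈ leavesᴹ x
    inˡ {i} p = subst (i ∈_) (sym (leaves-caterpillar left)) (∈-filter⁺ (λ i → f i Fin.≟ zero) (∈-allFin i) p)

    inʳ : ∀ {i} → f i ≢ zero → i ∈ leavesᴹ y
    inʳ {i} p = subst (i ∈_) (sym (leaves-caterpillar right)) (∈-filter⁺ (λ i → ¬? (f i Fin.≟ zero)) (∈-allFin i) p)

    size≡n : sizeᴹ (x ⊕ y) ≡ n
    size≡n = trans (cong sizeᴹ eq) (size-spanning t t↭)

    full : ∀ i j → f i ≢ f j → pairCost t i j ≡ n
    full i j fi≢fj = trans (cong (λ c → pairCostᴹ c i j) (sym eq)) (split (f i) (f j) refl refl)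
      where
      split : ∀ c d → f i ≡ c → f j ≡ d → pairCostᴹ (x ⊕ y) i j ≡ n
      split zero       zero       p q = contradiction (trans p (sym q)) fi≢fj
      split zero       (suc zero) p q = trans (pairCost-⊕-lr x y x#y (inˡ p) (inʳ λ r → contradiction (trans (sym q) r) λ ())) size≡n
      split (suc zero) zero       p q = trans (pairCost-⊕-rl x y x#y (inʳ λ r → contradiction (trans (sym p) r) λ ()) (inˡ q)) size≡n
      split (suc zero) (suc zero) p q = contradiction (trans p (sym q)) fi≢fj

+-cancelˡ-≤ : ∀ r {p q} → r + p ≤ r + q → p ≤ q
+-cancelˡ-≤ r {p} {q} r+p≤r+q = subst₂ _≤_ (cancel r p) (cancel r q) (ℚ.+-monoʳ-≤ (- r) r+p≤r+q)
  where
  cancel : ∀ r p → - r + (r + p) ≡ p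
  cancel = solve 2 (λ r p → :- r :+ (r :+ p) := p) refl

2* : ∀ p → ℕtoℚ 2 * p ≡ p + p
2* p = trans (ℚ.*-distribʳ-+ p 1ℚ 1ℚ) (cong₂ _+_ (ℚ.*-identityˡ p) (ℚ.*-identityˡ p))

-- A cut of at least half the weight, made at the root, already earns half of the trivial bound n W.
weight-≤-dis : ∀ {n} (w : Fin n → Fin n → ℚ) → (∀ i j → 0ℚ ≤ w i j) → 1 ℕ.≤ n → (O : ℚ) →
               (∀ t → IsHCTree t → IsBinary t → dis w t ≤ O) →
               ℕtoℚ n * pairSum (allFin n) w ≤ O + O
weight-≤-dis {n} w 0≤w 1≤n O optimal
  -- The argument 1 means two colours, so the pairs left uncut carry at most half of the weight.
  with colouring 1 (λ i j → ℕtoℚ n * w i j) (λ i j → 0≤* (0≤ℕtoℚ n) (0≤w i j)) (allFin n) (Unique.allFin⁺ n)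
... | f , f≤ with bisection 1≤n f
... | t , hc , bin , full = +-cancelˡ-≤ X (begin
  -- Doubling `X ≤ O + Y` and inserting `Y + Y ≤ X` leaves one `X` to cancel.
  X + X              ≤⟨ ℚ.+-mono-≤ X≤ X≤ ⟩
  (O + Y) + (O + Y)  ≡⟨ interchange O Y O Y ⟩
  (O + O) + (Y + Y)  ≤⟨ ℚ.+-monoʳ-≤ (O + O) Y+Y≤X ⟩
  (O + O) + X        ≡⟨ ℚ.+-comm (O + O) X ⟩
  X + (O + O)        ∎)
  where
  open ℚ.≤-Reasoning
  u v : Fin n → Fin n → ℚ
  u i j = ℕtoℚ n * w i j
  v i j = w i j * ℕtoℚ (pairCost t i j)
  X = ℕtoℚ n * pairSum (allFin n) w
  Y = pairSum (allFin n) (monoWeight f u)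

  u≤v : ∀ i j → f i ≢ f j → u i j ≤ v i j
  u≤v i j fi≢fj = ℚ.≤-reflexive (trans (ℚ.*-comm (ℕtoℚ n) (w i j)) (cong (λ k → w i j * ℕtoℚ k) (sym (full i j fi≢fj))))

  X≤ : X ≤ O + Y
  X≤ = begin
    X                                                       ≡⟨ pairSum-*ˡ (ℕtoℚ n) (allFin n) w ⟨
    pairSum (allFin n) u                                    ≤⟨ pairSum-mono-≤ (allFin n) (λ {i} {j} _ _ →
      monoWeight-split f u v i j (0≤* (0≤w i j) (0≤ℕtoℚ (pairCost t i j))) (u≤v i j)) ⟩
    pairSum (allFin n) (λ i j → v i j + monoWeight f u i j) ≡⟨ pairSum-+ (allFin n) v (monoWeight f u) ⟩
    pairSum (allFin n) v + Y                                ≡⟨ cong (_+ Y) (dis-pairSum w t) ⟨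
    dis w t + Y                                             ≤⟨ ℚ.+-monoˡ-≤ Y (optimal t hc bin) ⟩
    O + Y                                                   ∎

  Y+Y≤X : Y + Y ≤ X
  Y+Y≤X = begin
    Y + Y                ≡⟨ 2* Y ⟨
    ℕtoℚ 2 * Y           ≤⟨ f≤ ⟩
    pairSum (allFin n) u ≡⟨ pairSum-*ˡ (ℕtoℚ n) (allFin n) w ⟩
    X                    ∎

-- Choice of parameters

ℕtoℚ-suc : ∀ n → ℕtoℚ (suc n) ≡ ℕtoℚ n + 1ℚ
ℕtoℚ-suc n = trans (ℕtoℚ-+ 1 n) (ℚ.+-comm 1ℚ (ℕtoℚ n))

⅓ ⅛ : ℚ
⅓ = pos 1 ℚ./ 3
⅛ = pos 1 ℚ./ 8

-- The number of colours q, the threshold m for the pending set and the largest number e of children.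
record Parameters (n : ℕ) (ε : ℚ) : Set where
  field
    q₀ m e : ℕ
  q : ℕ
  q = suc q₀
  field
    -- The lower bound limits the monochromatic loss to half of `ε O`; the upper one limits the
    -- partly filled stars per flush.
    2≤εq     : ℕtoℚ 2 ≤ ε * ℕtoℚ q
    εq≤3     : ε * ℕtoℚ q ≤ ℕtoℚ 3
    -- The first estimate limits the loss due to pending points, the second the number of flushes.
    8m≤εn    : ℕtoℚ 8 * ℕtoℚ m ≤ ε * ℕtoℚ n
    εn≤8m+8  : ε * ℕtoℚ n ≤ ℕtoℚ 8 * ℕtoℚ (suc m)
    e≤3ε²n   : ℕtoℚ e ≤ ℕtoℚ 3 * (ε * ε) * ℕtoℚ n
    ε²n≤e    : ε * ε * ℕtoℚ n ≤ ℕtoℚ e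
    3≤e      : 3 ℕ.≤ e

module _ {n : ℕ} {ε : ℚ} (0<ε : 0ℚ < ε) (ε<1 : ε < 1ℚ) (1≤ε²n : 1ℚ ≤ ε * ε * ℕtoℚ n) where

  private
    N = ℕtoℚ n
    0≤ε = ℚ.<⇒≤ 0<ε
    0≤N = 0≤ℕtoℚ n

  -- All three are floors: `q₀` of 2/ε, `m` of εn/8 and `e` of 3ε²n. Passing from `q₀` to `q`
  -- secures `2≤εq` and adds only `ε < 1` to the product.
  parameters : Parameters n ε
  parameters
    with ⌊⌋-exists (ℕtoℚ 2 * 1/ε) (0≤* (0≤ℕtoℚ 2) 0≤1/ε)
       | ⌊⌋-exists (⅛ * (ε * N)) (0≤* (ℚ.nonNegative⁻¹ ⅛) (0≤* 0≤ε 0≤N))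
       | ⌊⌋-exists (ℕtoℚ 3 * (ε * ε) * N) (0≤* (0≤* (0≤ℕtoℚ 3) (0≤* 0≤ε 0≤ε)) 0≤N)
    where
    1/ε = (1/ ε) {{ℚ.pos⇒nonZero ε {{ℚ.positive 0<ε}}}}
    0≤1/ε : 0ℚ ≤ 1/ε
    0≤1/ε = ℚ.<⇒≤ (ℚ.positive⁻¹ 1/ε {{ℚ.1/pos⇒pos ε {{ℚ.positive 0<ε}}}})
  ... | q₀ , q₀≤ , <q | m , m≤ , <m+1 | e , e≤ , <e+1 = record
    { q₀ = q₀ ; m = m ; e = e
    ; 2≤εq = begin
        ℕtoℚ 2                  ≡⟨ ε*2/ε ⟨
        ε * (ℕtoℚ 2 * 1/ε)      ≤⟨ *-monoˡ-≤ 0≤ε (ℚ.<⇒≤ <q) ⟩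
        ε * ℕtoℚ (suc q₀)       ∎
    ; εq≤3 = begin
        ε * ℕtoℚ (suc q₀)       ≡⟨ cong (ε *_) (ℕtoℚ-suc q₀) ⟩
        ε * (ℕtoℚ q₀ + 1ℚ)      ≡⟨ ℚ.*-distribˡ-+ ε (ℕtoℚ q₀) 1ℚ ⟩
        ε * ℕtoℚ q₀ + ε * 1ℚ    ≤⟨ ℚ.+-mono-≤ (*-monoˡ-≤ 0≤ε q₀≤) (ℚ.≤-trans (ℚ.≤-reflexive (ℚ.*-identityʳ ε)) (ℚ.<⇒≤ ε<1)) ⟩
        ε * (ℕtoℚ 2 * 1/ε) + 1ℚ ≡⟨ cong (_+ 1ℚ) ε*2/ε ⟩
        ℕtoℚ 3                  ∎
    ; 8m≤εn = begin
        ℕtoℚ 8 * ℕtoℚ m          ≤⟨ *-monoˡ-≤ (0≤ℕtoℚ 8) m≤ ⟩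
        ℕtoℚ 8 * (⅛ * (ε * N))   ≡⟨ 8*⅛ ⟩
        ε * N                    ∎
    ; εn≤8m+8 = begin
        ε * N                    ≡⟨ 8*⅛ ⟨
        ℕtoℚ 8 * (⅛ * (ε * N))   ≤⟨ *-monoˡ-≤ (0≤ℕtoℚ 8) (ℚ.<⇒≤ <m+1) ⟩
        ℕtoℚ 8 * ℕtoℚ (suc m)    ∎
    ; e≤3ε²n = e≤
    -- Rounding 3ε²n down loses less than 1, and 1 is at most ε²n.
    ; ε²n≤e = +-cancelˡ-≤ 1ℚ (begin
        1ℚ + ε * ε * N            ≤⟨ ℚ.+-monoˡ-≤ (ε * ε * N) 1≤ε²n ⟩
        ε * ε * N + ε * ε * N     ≡⟨ 2* (ε * ε * N) ⟨
        ℕtoℚ 2 * (ε * ε * N)      ≤⟨ *-monoʳ-≤ (0≤* (0≤* 0≤ε 0≤ε) 0≤N) (ℕtoℚ-mono-≤ {2} {3} (ℕ.s≤s (ℕ.s≤s ℕ.z≤n))) ⟩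
        ℕtoℚ 3 * (ε * ε * N)      ≡⟨ ℚ.*-assoc (ℕtoℚ 3) (ε * ε) N ⟨
        ℕtoℚ 3 * (ε * ε) * N      ≤⟨ ℚ.<⇒≤ <e+1 ⟩
        ℕtoℚ (suc e)              ≡⟨ ℕtoℚ-+ 1 e ⟩
        1ℚ + ℕtoℚ e               ∎)
    ; 3≤e = ℕ.≤-pred (ℕtoℚ-cancel-< (begin-strict
        ℕtoℚ 3                    ≡⟨ ℚ.*-identityʳ (ℕtoℚ 3) ⟨
        ℕtoℚ 3 * 1ℚ               ≤⟨ *-monoˡ-≤ (0≤ℕtoℚ 3) 1≤ε²n ⟩
        ℕtoℚ 3 * (ε * ε * N)      ≡⟨ ℚ.*-assoc (ℕtoℚ 3) (ε * ε) N ⟨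
        ℕtoℚ 3 * (ε * ε) * N      <⟨ <e+1 ⟩
        ℕtoℚ (suc e)              ∎))
    }
    where
    open ℚ.≤-Reasoning
    instance
      ε≢0 : ℚ.NonZero ε
      ε≢0 = ℚ.pos⇒nonZero ε {{ℚ.positive 0<ε}}
    1/ε = 1/ ε
    ε*2/ε : ε * (ℕtoℚ 2 * 1/ε) ≡ ℕtoℚ 2
    ε*2/ε = trans (cong (ε *_) (ℚ.*-comm (ℕtoℚ 2) 1/ε))
      (trans (sym (ℚ.*-assoc ε 1/ε (ℕtoℚ 2))) (trans (cong (_* ℕtoℚ 2) (ℚ.*-inverseʳ ε)) (ℚ.*-identityˡ (ℕtoℚ 2))))
    8*⅛ : ℕtoℚ 8 * (⅛ * (ε * N)) ≡ ε * N
    8*⅛ = trans (sym (ℚ.*-assoc (ℕtoℚ 8) ⅛ (ε * N))) (ℚ.*-identityˡ (ε * N))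

  -- With n at most 1, ε²n would be at most ε², which is below 1.
  2≤n : 2 ℕ.≤ n
  2≤n = ℕtoℚ-cancel-< (ℚ.≰⇒> λ N≤1 → ℚ.<-irrefl refl (begin-strict
    1ℚ              ≤⟨ 1≤ε²n ⟩
    ε * ε * N       ≤⟨ *-monoˡ-≤ (0≤* 0≤ε 0≤ε) N≤1 ⟩
    ε * ε * 1ℚ      ≡⟨ ℚ.*-identityʳ (ε * ε) ⟩
    ε * ε           ≤⟨ *-monoˡ-≤ 0≤ε (ℚ.<⇒≤ ε<1) ⟩
    ε * 1ℚ          ≡⟨ ℚ.*-identityʳ ε ⟩
    ε               <⟨ ε<1 ⟩
    1ℚ              ∎))
    where open ℚ.≤-Reasoning

  module _ (P : Parameters n ε) where
    open Parameters P

    private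
      0<N : 0ℚ < N
      0<N = ℚ.<-≤-trans (ℚ.positive⁻¹ 1ℚ) (ℕtoℚ-mono-≤ {1} (ℕ.<⇒≤ 2≤n))
      0<E : 0ℚ < ℕtoℚ e
      0<E = ℚ.<-≤-trans (ℚ.positive⁻¹ 1ℚ) (ℕtoℚ-mono-≤ {1} (ℕ.≤-trans (ℕ.s≤s ℕ.z≤n) 3≤e))

    -- The constant is 8 for the flushes of more than `m` points each, plus 1 for the final flush.
    flushes-≤ : ∀ k → k ℕ.* suc m ℕ.≤ n → ε * ℕtoℚ (suc k) ≤ ℕtoℚ 9
    flushes-≤ k k≤ = begin
      ε * ℕtoℚ (suc k)           ≡⟨ cong (ε *_) (ℕtoℚ-suc k) ⟩
      ε * (ℕtoℚ k + 1ℚ)          ≡⟨ ℚ.*-distribˡ-+ ε (ℕtoℚ k) 1ℚ ⟩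
      ε * ℕtoℚ k + ε * 1ℚ        ≤⟨ ℚ.+-mono-≤ εk≤8 (ℚ.≤-trans (ℚ.≤-reflexive (ℚ.*-identityʳ ε)) (ℚ.<⇒≤ ε<1)) ⟩
      ℕtoℚ 9                     ∎
      where
      open ℚ.≤-Reasoning
      εk≤8 : ε * ℕtoℚ k ≤ ℕtoℚ 8
      εk≤8 = *-cancelʳ-≤ 0<N (begin
        ε * ℕtoℚ k * N                   ≡⟨ solve 3 (λ ε k N → ε :* k :* N := k :* (ε :* N)) refl ε (ℕtoℚ k) N ⟩
        ℕtoℚ k * (ε * N)                 ≤⟨ *-monoˡ-≤ (0≤ℕtoℚ k) εn≤8m+8 ⟩
        ℕtoℚ k * (ℕtoℚ 8 * ℕtoℚ (suc m)) ≡⟨ solve 3 (λ c k m → k :* (c :* m) := c :* (k :* m)) refl (ℕtoℚ 8) (ℕtoℚ k) (ℕtoℚ (suc m)) ⟩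
        ℕtoℚ 8 * (ℕtoℚ k * ℕtoℚ (suc m)) ≡⟨ cong (ℕtoℚ 8 *_) (ℕtoℚ-* k (suc m)) ⟨
        ℕtoℚ 8 * ℕtoℚ (k ℕ.* suc m)      ≤⟨ *-monoˡ-≤ (0≤ℕtoℚ 8) (ℕtoℚ-mono-≤ k≤) ⟩
        ℕtoℚ 8 * N                       ∎)

    -- 56 is 2 (1 + 9 · 3): the 1 comes from full stars through `ε²n≤e`, and 9 · 3 from flushes
    -- times colours. The `suc v` is the weight of a tree with `v` internal nodes.
    numInternal-≤ : ∀ k v → k ℕ.* suc m ℕ.≤ n → suc v ℕ.* e ℕ.≤ 2 ℕ.* (n ℕ.+ suc k ℕ.* (q ℕ.* e)) →
                    ℕtoℚ v * (ε * ε) ≤ ℕtoℚ 56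
    numInternal-≤ k v k≤ light = *-cancelʳ-≤ 0<E (begin
      V * (ε * ε) * E                 ≡⟨ solve 3 (λ V ε² E → V :* ε² :* E := ε² :* (V :* E)) refl V (ε * ε) E ⟩
      ε * ε * (V * E)                 ≤⟨ *-monoˡ-≤ (0≤* 0≤ε 0≤ε) light′ ⟩
      ε * ε * (ℕtoℚ 2 * (N + F * (Q * E)))
        ≡⟨ solve 6 (λ ε c N F Q E → ε :* ε :* (c :* (N :+ F :* (Q :* E))) := c :* (ε :* ε :* N :+ (ε :* F) :* (ε :* Q) :* E)) refl ε (ℕtoℚ 2) N F Q E ⟩
      ℕtoℚ 2 * (ε * ε * N + (ε * F) * (ε * Q) * E)
        ≤⟨ *-monoˡ-≤ (0≤ℕtoℚ 2) (ℚ.+-mono-≤ ε²n≤e (*-monoʳ-≤ (0≤ℕtoℚ e)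
             (ℚ.≤-trans (*-monoˡ-≤ (0≤* 0≤ε (0≤ℕtoℚ (suc k))) εq≤3) (*-monoʳ-≤ (0≤ℕtoℚ 3) (flushes-≤ k k≤))))) ⟩
      ℕtoℚ 2 * (E + ℕtoℚ 9 * ℕtoℚ 3 * E)  ≡⟨ cong (λ z → ℕtoℚ 2 * (z + ℕtoℚ 27 * E)) (ℚ.*-identityˡ E) ⟨
      ℕtoℚ 2 * (1ℚ * E + ℕtoℚ 27 * E)     ≡⟨ cong (ℕtoℚ 2 *_) (ℚ.*-distribʳ-+ E 1ℚ (ℕtoℚ 27)) ⟨
      ℕtoℚ 2 * (ℕtoℚ 28 * E)              ≡⟨ ℚ.*-assoc (ℕtoℚ 2) (ℕtoℚ 28) E ⟨
      ℕtoℚ 56 * E                         ∎)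
      where
      open ℚ.≤-Reasoning
      V = ℕtoℚ v
      E = ℕtoℚ e
      F = ℕtoℚ (suc k)
      Q = ℕtoℚ q
      light′ : V * E ≤ ℕtoℚ 2 * (N + F * (Q * E))
      light′ = begin
        V * E                                               ≡⟨ ℕtoℚ-* v e ⟨
        ℕtoℚ (v ℕ.* e)                                      ≤⟨ ℕtoℚ-mono-≤ (ℕ.≤-trans (ℕ.m≤n+m (v ℕ.* e) e) light) ⟩
        ℕtoℚ (2 ℕ.* (n ℕ.+ suc k ℕ.* (q ℕ.* e)))            ≡⟨ ℕtoℚ-* 2 (n ℕ.+ suc k ℕ.* (q ℕ.* e)) ⟩
        ℕtoℚ 2 * ℕtoℚ (n ℕ.+ suc k ℕ.* (q ℕ.* e))           ≡⟨ cong (ℕtoℚ 2 *_) (ℕtoℚ-+ n (suc k ℕ.* (q ℕ.* e))) ⟩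
        ℕtoℚ 2 * (N + ℕtoℚ (suc k ℕ.* (q ℕ.* e)))           ≡⟨ cong (λ z → ℕtoℚ 2 * (N + z)) (trans (ℕtoℚ-* (suc k) (q ℕ.* e)) (cong (F *_) (ℕtoℚ-* q e))) ⟩
        ℕtoℚ 2 * (N + F * (Q * E))                          ∎

    numInternal-≥ : ∀ v → n ℕ.≤ v ℕ.* e → ⅓ ≤ ℕtoℚ v * (ε * ε)
    numInternal-≥ v n≤ = *-cancelʳ-≤ {r = ℕtoℚ 3} (ℚ.positive⁻¹ (ℕtoℚ 3)) (*-cancelʳ-≤ 0<N (begin
      1ℚ * N                             ≡⟨ ℚ.*-identityˡ N ⟩
      N                                  ≤⟨ ℕtoℚ-mono-≤ n≤ ⟩
      ℕtoℚ (v ℕ.* e)                     ≡⟨ ℕtoℚ-* v e ⟩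
      ℕtoℚ v * ℕtoℚ e                    ≤⟨ *-monoˡ-≤ (0≤ℕtoℚ v) e≤3ε²n ⟩
      ℕtoℚ v * (ℕtoℚ 3 * (ε * ε) * N)    ≡⟨ solve 4 (λ v c s N → v :* (c :* s :* N) := v :* s :* c :* N) refl (ℕtoℚ v) (ℕtoℚ 3) (ε * ε) N ⟩
      ℕtoℚ v * (ε * ε) * ℕtoℚ 3 * N      ∎))
      where open ℚ.≤-Reasoning

    -- Each of the two losses, Y (equally coloured pairs) and 2 m W, is at most half of ε O.
    dis-≥ : ∀ {O D Y W} → 0ℚ ≤ Y → 0ℚ ≤ W → ℕtoℚ q * Y ≤ O → N * W ≤ O + O →
            O ≤ D + Y + ℕtoℚ (2 ℕ.* m) * W → (1ℚ - ε) * O ≤ D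
    dis-≥ {O} {D} {Y} {W} 0≤Y 0≤W qY≤O NW≤2O O≤ = +-cancelˡ-≤ (ε * O) (begin
      ε * O + (1ℚ - ε) * O    ≡⟨ ℚ.*-distribʳ-+ O ε (1ℚ - ε) ⟨
      (ε + (1ℚ - ε)) * O      ≡⟨ cong (_* O) (solve 2 (λ o ε → ε :+ (o :- ε) := o) refl 1ℚ ε) ⟩
      1ℚ * O                  ≡⟨ ℚ.*-identityˡ O ⟩
      O                       ≤⟨ O≤ ⟩
      D + Y + Z               ≡⟨ solve 3 (λ D Y Z → D :+ Y :+ Z := (Y :+ Z) :+ D) refl D Y Z ⟩
      (Y + Z) + D             ≤⟨ ℚ.+-monoˡ-≤ D Y+Z≤ ⟩
      ε * O + D               ∎)
      where
      open ℚ.≤-Reasoning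
      Z = ℕtoℚ (2 ℕ.* m) * W
      double-cancel : ∀ {p q} → p + p ≤ q + q → p ≤ q
      double-cancel {p} {q} 2p≤2q = *-cancelʳ-≤ {r = ℕtoℚ 2} (ℚ.positive⁻¹ (ℕtoℚ 2))
        (subst₂ _≤_ (trans (sym (2* p)) (ℚ.*-comm (ℕtoℚ 2) p)) (trans (sym (2* q)) (ℚ.*-comm (ℕtoℚ 2) q)) 2p≤2q)

      2Y≤ : Y + Y ≤ ε * O
      2Y≤ = begin
        Y + Y             ≡⟨ 2* Y ⟨
        ℕtoℚ 2 * Y        ≤⟨ *-monoʳ-≤ 0≤Y 2≤εq ⟩
        ε * ℕtoℚ q * Y    ≡⟨ ℚ.*-assoc ε (ℕtoℚ q) Y ⟩
        ε * (ℕtoℚ q * Y)  ≤⟨ *-monoˡ-≤ 0≤ε qY≤O ⟩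
        ε * O             ∎

      2Z≤ : Z + Z ≤ ε * O
      -- Doubling twice exposes the factor 8 of `8m≤εn`: 4 Z = 8 m W ≤ ε N W ≤ 2 ε O.
      2Z≤ = double-cancel (begin
        (Z + Z) + (Z + Z)                     ≡⟨ cong₂ _+_ (2* Z) (2* Z) ⟨
        ℕtoℚ 2 * Z + ℕtoℚ 2 * Z               ≡⟨ 2* (ℕtoℚ 2 * Z) ⟨
        ℕtoℚ 2 * (ℕtoℚ 2 * Z)                 ≡⟨ cong (λ z → ℕtoℚ 2 * (ℕtoℚ 2 * (z * W))) (ℕtoℚ-* 2 m) ⟩
        ℕtoℚ 2 * (ℕtoℚ 2 * (ℕtoℚ 2 * ℕtoℚ m * W))
          ≡⟨ solve 3 (λ c m W → c :* (c :* (c :* m :* W)) := c :* c :* c :* m :* W) refl (ℕtoℚ 2) (ℕtoℚ m) W ⟩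
        ℕtoℚ 8 * ℕtoℚ m * W                   ≤⟨ *-monoʳ-≤ 0≤W 8m≤εn ⟩
        ε * N * W                             ≡⟨ ℚ.*-assoc ε N W ⟩
        ε * (N * W)                           ≤⟨ *-monoˡ-≤ 0≤ε NW≤2O ⟩
        ε * (O + O)                           ≡⟨ ℚ.*-distribˡ-+ ε O O ⟩
        ε * O + ε * O                         ∎)

      Y+Z≤ : Y + Z ≤ ε * O
      Y+Z≤ = double-cancel (begin
        (Y + Z) + (Y + Z)   ≡⟨ interchange Y Z Y Z ⟩
        (Y + Y) + (Z + Z)   ≤⟨ ℚ.+-mono-≤ 2Y≤ 2Z≤ ⟩
        ε * O + ε * O       ∎)

-- Assembling the approximation

dis-approximation : ∀ {n ε} → 0ℚ < ε → ε < 1ℚ → 1ℚ ≤ ε * ε * ℕtoℚ n → (P : Parameters n ε) →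
  let open Parameters P in
  (w : Fin n → Fin n → ℚ) → (∀ i j → 0ℚ ≤ w i j) → (TO T : Tree n) (f : Fin n → Fin q) →
  (∀ t → IsHCTree t → IsBinary t → dis w t ≤ dis w TO) →
  ℕtoℚ q * pairSum (allFin n) (monoWeight f (λ i j → w i j * ℕtoℚ (pairCost TO i j))) ≤ dis w TO →
  (∀ i j → f i ≢ f j → pairCost TO i j ℕ.≤ pairCost T i j ℕ.+ 2 ℕ.* m) →
  (1ℚ - ε) * dis w TO ≤ dis w T
dis-approximation {n} {ε} 0<ε ε<1 1≤ε²n P w 0≤w TO T f optimal f≤ loss =
  dis-≥ 0<ε ε<1 1≤ε²n P (0≤pairSum L (0≤monoWeight f u 0≤u)) (0≤pairSum L 0≤w) f≤
    (weight-≤-dis w 0≤w (ℕ.<⇒≤ (2≤n 0<ε ε<1 1≤ε²n)) (dis w TO) optimal) total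
  where
  open Parameters P
  open ℚ.≤-Reasoning
  L = allFin n

  u v z : Fin n → Fin n → ℚ
  u i j = w i j * ℕtoℚ (pairCost TO i j)
  v i j = w i j * ℕtoℚ (pairCost T i j)
  z i j = ℕtoℚ (2 ℕ.* m) * w i j
  Y = pairSum L (monoWeight f u)

  0≤u : ∀ i j → 0ℚ ≤ u i j
  0≤u i j = 0≤* (0≤w i j) (0≤ℕtoℚ (pairCost TO i j))

  apart≤ : ∀ i j → f i ≢ f j → u i j ≤ v i j + z i j
  apart≤ i j fi≢fj = begin
    w i j * ℕtoℚ (pairCost TO i j)                   ≤⟨ *-monoˡ-≤ (0≤w i j) (ℕtoℚ-mono-≤ (loss i j fi≢fj)) ⟩
    w i j * ℕtoℚ (pairCost T i j ℕ.+ 2 ℕ.* m)        ≡⟨ cong (w i j *_) (ℕtoℚ-+ (pairCost T i j) (2 ℕ.* m)) ⟩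
    w i j * (ℕtoℚ (pairCost T i j) + ℕtoℚ (2 ℕ.* m)) ≡⟨ ℚ.*-distribˡ-+ (w i j) (ℕtoℚ (pairCost T i j)) (ℕtoℚ (2 ℕ.* m)) ⟩
    v i j + w i j * ℕtoℚ (2 ℕ.* m)                   ≡⟨ cong (v i j +_) (ℚ.*-comm (w i j) (ℕtoℚ (2 ℕ.* m))) ⟩
    v i j + z i j                                    ∎

  0≤v+z : ∀ i j → 0ℚ ≤ v i j + z i j
  0≤v+z i j = ℚ.+-mono-≤ (0≤* (0≤w i j) (0≤ℕtoℚ (pairCost T i j))) (0≤* (0≤ℕtoℚ (2 ℕ.* m)) (0≤w i j))

  total : dis w TO ≤ dis w T + Y + ℕtoℚ (2 ℕ.* m) * pairSum L w
  total = begin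
    dis w TO                                                  ≡⟨ dis-pairSum w TO ⟩
    -- Equally coloured pairs are written off into `Y`; every other pair loses at most `2 m` times
    -- its weight.
    pairSum L u                                               ≤⟨ pairSum-mono-≤ L (λ {i} {j} _ _ →
      monoWeight-split f u (λ i j → v i j + z i j) i j (0≤v+z i j) (apart≤ i j)) ⟩
    pairSum L (λ i j → (v i j + z i j) + monoWeight f u i j)  ≡⟨ pairSum-+ L (λ i j → v i j + z i j) (monoWeight f u) ⟩
    pairSum L (λ i j → v i j + z i j) + Y                     ≡⟨ cong (_+ Y) (pairSum-+ L v z) ⟩
    pairSum L v + pairSum L z + Y                             ≡⟨ solve 3 (λ a b c → a :+ b :+ c := a :+ c :+ b) refl (pairSum L v) (pairSum L z) Y ⟩
    pairSum L v + Y + pairSum L z                             ≡⟨ cong₂ (λ d s → d + Y + s) (sym (dis-pairSum w T)) (pairSum-*ˡ (ℕtoℚ (2 ℕ.* m)) L w) ⟩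
    dis w T + Y + ℕtoℚ (2 ℕ.* m) * pairSum L w                ∎

-- Θ(1/ε²) is stated after multiplication by ε², with the explicit constants 1/3 and 56.
Approximation : ∀ {n} → (Fin n → Fin n → ℚ) → ℚ → Tree n → Set
Approximation {n} w ε TO = Σ (Tree n) λ T → IsHCTree T
  × ⅓ ≤ ℕtoℚ (numInternal T) * (ε * ε)
  × ℕtoℚ (numInternal T) * (ε * ε) ≤ ℕtoℚ 56
  × All (λ cs → ℕtoℚ (length cs) ≤ ℕtoℚ 3 * (ε * ε) * ℕtoℚ n) (internalNodes T)
  × (1ℚ - ε) * dis w TO ≤ dis w T

approximation : ∀ {n ε} → 0ℚ < ε → ε < 1ℚ → 1ℚ ≤ ε * ε * ℕtoℚ n → Parameters n ε →
  (w : Fin n → Fin n → ℚ) → (∀ i j → 0ℚ ≤ w i j) → (TO : Tree n) → leaves TO ↭ allFin n → IsBinary TO →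
  (∀ t → IsHCTree t → IsBinary t → dis w t ≤ dis w TO) →
  Approximation w ε TO
approximation {n} {ε} 0<ε ε<1 1≤ε²n P w 0≤w TO TO↭ binary optimal =
  let f , f≤ = colouring q₀ (λ i j → w i j * ℕtoℚ (pairCost TO i j))
                 (λ i j → 0≤* (0≤w i j) (0≤ℕtoℚ (pairCost TO i j))) (allFin n) (Unique.allFin⁺ n)
      c , k , c↭ , arity , k≤ , light , loss =
        coarsening {m = m} (ℕ.≤-trans (ℕ.n≤1+n 2) 3≤e) f TO binary (Unique-resp-↭ (↭-sym TO↭) (Unique.allFin⁺ n))
  in conclude f (ℚ.≤-trans f≤ (ℚ.≤-reflexive (sym (dis-pairSum w TO)))) c k
       (↭-trans c↭ TO↭) arity (subst (k ℕ.* suc m ℕ.≤_) TO≡n k≤)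
       (subst (λ s → weight c ℕ.* e ℕ.≤ 2 ℕ.* (s ℕ.+ suc k ℕ.* (q ℕ.* e))) TO≡n light)
       (λ i j → loss (∈-TO i) (∈-TO j))
  where
  open Parameters P
  TO≡n = size-spanning TO TO↭
  ∈-TO : ∀ i → i ∈ leaves TO
  ∈-TO i = Perm.∈-resp-↭ (↭-sym TO↭) (∈-allFin i)

  conclude : (f : Fin n → Fin q) →
    ℕtoℚ q * pairSum (allFin n) (monoWeight f (λ i j → w i j * ℕtoℚ (pairCost TO i j))) ≤ dis w TO →
    ∀ c k → leavesᴹ c ↭ allFin n → All (Arity e) (internalNodesᴹ c) → k ℕ.* suc m ℕ.≤ n →
    weight c ℕ.* e ℕ.≤ 2 ℕ.* (n ℕ.+ suc k ℕ.* (q ℕ.* e)) →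
    (∀ i j → f i ≢ f j → pairCost TO i j ℕ.≤ pairCostᴹ c i j ℕ.+ 2 ℕ.* m) → Approximation w ε TO
  -- As `n` is at least 2, the core is neither empty nor a leaf. An internal root lets `size-node-≤`
  -- give `n ≤ v * e` without the additional 1.
  conclude f f≤ nothing k c↭ =
    contradiction (proj₂ (unwrap (ℕ.<⇒≤ (2≤n 0<ε ε<1 1≤ε²n)) nothing c↭)) λ ()
  conclude f f≤ (just (leaf x)) k T↭ =
    contradiction (size-spanning (leaf x) T↭) (ℕ.<⇒≢ (2≤n 0<ε ε<1 1≤ε²n))
  conclude f f≤ (just T@(node cs)) k T↭ arity k≤ light loss =
    T , (All.map proj₁ arity , T↭) ,
    numInternal-≥ 0<ε ε<1 1≤ε²n P (numInternal T)
      (subst (ℕ._≤ numInternal T ℕ.* e) (size-spanning T T↭) (size-node-≤ cs (All.map proj₂ arity))) ,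
    numInternal-≤ 0<ε ε<1 1≤ε²n P k (numInternal T) k≤ light ,
    All.map (λ (_ , ≤e) → ℚ.≤-trans (ℕtoℚ-mono-≤ ≤e) e≤3ε²n) arity ,
    dis-approximation 0<ε ε<1 1≤ε²n P w 0≤w TO T f optimal f≤ loss

theorem4 : Σ ℚ λ c₁ → Σ ℚ λ c₂ → 0ℚ < c₁ × 0ℚ < c₂ ×
    ((n : ℕ) (w : Fin n → Fin n → ℚ) → (∀ i j → 0ℚ ≤ w i j × w i j ≤ 1ℚ) →
    (TO : Tree n) → IsHCTree TO → IsBinary TO →
    (∀ (T : Tree n) → IsHCTree T → IsBinary T → dis w T ≤ dis w TO) →
    (ε : ℚ) → 0ℚ < ε → ε < 1ℚ → 1ℚ ≤ ε * ε * ℕtoℚ n →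
    Σ (Tree n) λ Tbar → IsHCTree Tbar
    × c₁ ≤ ℕtoℚ (numInternal Tbar) * (ε * ε)
    × ℕtoℚ (numInternal Tbar) * (ε * ε) ≤ c₂
    × All (λ cs → ℕtoℚ (length cs) ≤ ℕtoℚ 3 * (ε * ε) * ℕtoℚ n) (internalNodes Tbar)
    × (1ℚ - ε) * dis w TO ≤ dis w Tbar)
theorem4 = ⅓ , ℕtoℚ 56 , ℚ.positive⁻¹ ⅓ , ℚ.positive⁻¹ (ℕtoℚ 56) ,
  λ n w w∈ TO (_ , TO↭) binary optimal ε 0<ε ε<1 1≤ε²n →
    approximation 0<ε ε<1 1≤ε²n (parameters 0<ε ε<1 1≤ε²n) w (λ i j → proj₁ (w∈ i j)) TO TO↭ binary optimal
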